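{- Let $n,r$ be integers with $1\le r<n/2$, let $\delta$ be a real number with $\delta<10^{ -3}n^{ -4}$, and let $G$ be an intersecting $r$-graph on $n$ vertices with $|G|>(1-\delta)\binom{n-1}{r-1}$. Then there is a vertex $v$ of $G$ such that all but at most $25n\delta^{1/2}\binom{n-1}{r-1}$ edges of $G$ contain $v$.
   Context: An $r$-graph $G$ consists of a finite vertex set $V(G)$ and a set $E(G)$ of edges, each edge being an $r$-element subset of $V(G)$; $|G|=|E(G)|$. An $r$-graph is intersecting if every two of its edges have at least one common vertex. -}

module Defs where

open import Data.Empty using (⊥-elim)
open import Data.Fin.Base using (Fin)
open import Data.Fin.Subset using (Subset; Nonempty; _∩_; ∣_∣)
open import Data.Fin.Subset.Properties using (_∈?_)
open import Data.Integer.Base using (+_)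
open import Data.List.Base using (List; length; filter)
open import Data.List.Membership.Propositional using (_∈_)
open import Data.List.Relation.Unary.All using (All)
open import Data.List.Relation.Unary.Unique.Propositional using (Unique)
open import Data.Nat.Base as ℕ using (ℕ; zero; suc)
import Data.Nat.Properties as ℕ
open import Data.Product.Base using (∃; _×_; _,_)
open import Data.Rational.Base hiding (∣_∣)
open import Data.Rational.Properties
open import Data.Rational.Solver using (module +-*-Solver)
open import Data.Sum.Base using (_⊎_; inj₁; inj₂; swap)
open import Relation.Binary.Definitions using (tri<; tri≈; tri>)
open import Relation.Binary.PropositionalEquality
  using (_≡_; refl; sym; trans; cong; subst)
open import Relation.Nullary using (¬_; ¬?; yes; no)

record RGraph (r n : ℕ) : Set where
  field
    edges   : List (Subset n)
    unique  : Unique edges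
    uniform : All (λ e → ∣ e ∣ ≡ r) edges

  size : ℕ
  size = length edges

  Intersecting : Set
  Intersecting = ∀ {e f} → e ∈ edges → f ∈ edges → Nonempty (e ∩ f)

  sizeAvoiding : Fin n → ℕ
  sizeAvoiding v = length (filter (λ e → ¬? (v ∈? e)) edges)

-- Dedekind reals (two-sided located cuts)
record ℝ : Set₁ where
  field
    L U         : ℚ → Set
    L-inhabited : ∃ L
    U-inhabited : ∃ U
    L-lower     : ∀ {p q} → p < q → L q → L p
    U-upper     : ∀ {p q} → p < q → U p → U q
    L-open      : ∀ {q} → L q → ∃ λ p → q < p × L p
    U-open      : ∀ {q} → U q → ∃ λ p → p < q × U p
    disjoint    : ∀ {q} → ¬ (L q × U q)
    located     : ∀ {p q} → p < q → L p ⊎ U q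

  L<U : ∀ {p q} → L p → U q → p < q
  L<U {p} {q} Lp Uq with <-cmp p q
  ... | tri< p<q _ _  = p<q
  ... | tri≈ _ refl _ = ⊥-elim (disjoint (Lp , Uq))
  ... | tri> _ _ q<p  = ⊥-elim (disjoint (L-lower q<p Lp , Uq))

infix 4 _<ℝ_ _≤ℝ_

_<ℝ_ : ℝ → ℝ → Set
x <ℝ y = ∃ λ q → ℝ.U x q × ℝ.L y q

_≤ℝ_ : ℝ → ℝ → Set
x ≤ℝ y = ¬ (y <ℝ x)

private
  p<p+1 : ∀ p → p < p + 1ℚ
  p<p+1 p = subst (_< p + 1ℚ) (+-identityʳ p) (+-monoʳ-< p (positive⁻¹ 1ℚ))

  p-1<p : ∀ p → p - 1ℚ < p
  p-1<p p = subst (p - 1ℚ <_) (+-identityʳ p) (+-monoʳ-< p (negative⁻¹ (- 1ℚ)))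

  c-[c-p]≡p : ∀ c p → c - (c - p) ≡ p
  c-[c-p]≡p = solve 2 (λ c p → c :- (c :- p) := p) refl
    where open +-*-Solver

  c-antimono : ∀ c {p q} → p < q → c - q < c - p
  c-antimono c p<q = +-monoʳ-< c (neg-antimono-< p<q)

  c-swapˡ : ∀ c {p q} → p < c - q → q < c - p
  c-swapˡ c {p} {q} lt = subst (_< c - p) (c-[c-p]≡p c q) (c-antimono c lt)

  c-swapʳ : ∀ c {p q} → c - q < p → c - p < q
  c-swapʳ c {p} {q} lt = subst (c - p <_) (c-[c-p]≡p c q) (c-antimono c lt)

  0<* : ∀ {p q} → 0ℚ < p → 0ℚ < q → 0ℚ < p * q
  0<* {p} {q} 0<p 0<q = subst (_< p * q) (*-zeroʳ p)
    (*-monoʳ-<-pos p {{positive 0<p}} 0<q)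

  0≤* : ∀ {p q} → 0ℚ ≤ p → 0ℚ ≤ q → 0ℚ ≤ p * q
  0≤* {p} {q} 0≤p 0≤q = subst (_≤ p * q) (*-zeroʳ p)
    (*-monoˡ-≤-nonNeg p {{nonNegative 0≤p}} 0≤q)

  0<⇒<+ : ∀ p {q} → 0ℚ < q → p < p + q
  0<⇒<+ p 0<q = subst (_< p + _) (+-identityʳ p) (+-monoʳ-< p 0<q)

  <⇒0<- : ∀ {p q} → p < q → 0ℚ < q - p
  <⇒0<- {p} {q} p<q = subst (_< q - p) (+-inverseʳ p) (+-monoˡ-< (- p) p<q)

  square-mono : ∀ {p q} → 0ℚ ≤ p → p < q → p * p < q * q
  square-mono {p} {q} 0≤p p<q = ≤-<-trans
    (*-monoˡ-≤-nonNeg p {{nonNegative 0≤p}} (<⇒≤ p<q))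
    (*-monoˡ-<-pos q {{positive (≤-<-trans 0≤p p<q)}} p<q)

  recip : ∀ {p} → 0ℚ < p → ∃ λ i → 0ℚ < i × p * i ≡ 1ℚ
  recip {p} 0<p = 1/ p , positive⁻¹ (1/ p) {{1/pos⇒pos p}} , *-inverseʳ p
    where instance
    p-pos = positive 0<p
    p≢0   = pos⇒nonZero p

  *-cancel : ∀ {d i} s → d * i ≡ 1ℚ → d * (s * i) ≡ s
  *-cancel {d} {i} s d*i≡1 = trans
    (solve 3 (λ d s i → d :* (s :* i) := s :* (d :* i)) refl d s i)
    (trans (cong (s *_) d*i≡1) (*-identityʳ s))
    where open +-*-Solver

  -- r = (s + q c) / (q + c) with c = s + 1, for which c² > s
  square-openˡ : ∀ {q s} → 0ℚ ≤ q → q * q < s → ∃ λ r → q < r × r * r < s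
  square-openˡ {q} {s} 0≤q q²<s with recip 0<D
    where
    0<D : 0ℚ < q + (s + 1ℚ)
    0<D = +-mono-≤-< 0≤q (<-trans (≤-<-trans (0≤* 0≤q 0≤q) q²<s) (p<p+1 s))
  ... | i , 0<i , D*i≡1 = r , q<r , r²<s
    where
    open +-*-Solver
    c = s + 1ℚ
    D = q + c
    r = (s + q * c) * i
    0<s : 0ℚ < s
    0<s = ≤-<-trans (0≤* 0≤q 0≤q) q²<s
    gap = (s - q * q) * (s * s + c) * (i * i)
    0<gap : 0ℚ < gap
    0<gap = 0<* (0<* (<⇒0<- q²<s) (+-mono-< (0<* 0<s 0<s) (<-trans 0<s (p<p+1 s))))
                (0<* 0<i 0<i)
    q<r : q < r
    q<r = subst (_< r)
      (trans (solve 3 (λ q c i → (q :* q :+ q :* c) :* i := q :* ((q :+ c) :* i)) refl q c i)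
        (trans (cong (q *_) D*i≡1) (*-identityʳ q)))
      (*-monoˡ-<-pos i {{positive 0<i}} (+-monoˡ-< (q * c) q²<s))
    eq : r * r + gap ≡ s
    eq = trans
      (solve 3 (λ s q i →
        let c = s :+ con 1ℚ ; r = (s :+ q :* c) :* i in
        r :* r :+ (s :- q :* q) :* (s :* s :+ c) :* (i :* i)
          := s :* (((q :+ c) :* i) :* ((q :+ c) :* i))) refl s q i)
      (trans (cong (λ z → s * (z * z)) D*i≡1) (*-identityʳ s))
    r²<s : r * r < s
    r²<s = subst (r * r <_) eq (0<⇒<+ (r * r) 0<gap)

  -- p = (q + t / q) / 2
  newton : ∀ {q t} → 0ℚ < q → 0ℚ ≤ t → t < q * q →
           ∃ λ p → 0ℚ < p × p < q × t < p * p
  newton {q} {t} 0<q 0≤t t<q² with recip 0<q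
  ... | i , 0<i , q*i≡1 = p , 0<p , p<q , t<p²
    where
    open +-*-Solver
    p = ½ * (q + t * i)
    0<p : 0ℚ < p
    0<p = 0<* (positive⁻¹ ½) (+-mono-<-≤ 0<q (0≤* 0≤t (<⇒≤ 0<i)))
    ti<q : t * i < q
    ti<q = subst (t * i <_)
      (trans (*-assoc q q i) (trans (cong (q *_) q*i≡1) (*-identityʳ q)))
      (*-monoˡ-<-pos i {{positive 0<i}} t<q²)
    p<q : p < q
    p<q = subst (p <_) (solve 1 (λ q → con ½ :* (q :+ q) := q) refl q)
      (*-monoʳ-<-pos ½ (+-monoʳ-< q ti<q))
    gap = (½ * (q - t * i)) * (½ * (q - t * i))
    0<gap : 0ℚ < gap
    0<gap = 0<* (0<* (positive⁻¹ ½) (<⇒0<- ti<q)) (0<* (positive⁻¹ ½) (<⇒0<- ti<q))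
    eq : t + gap ≡ p * p
    eq = trans (cong (_+ gap) (sym (trans (cong (t *_) q*i≡1) (*-identityʳ t))))
      (solve 3 (λ q t i →
        let d = con ½ :* (q :- t :* i) ; p = con ½ :* (q :+ t :* i) in
        t :* (q :* i) :+ d :* d := p :* p) refl q t i)
    t<p² : t < p * p
    t<p² = subst (t <_) eq (0<⇒<+ t 0<gap)

  square-openʳ : ∀ {q t} → 0ℚ < q → t < q * q →
                 ∃ λ p → 0ℚ < p × p < q × t < p * p
  square-openʳ {q} {t} 0<q t<q² with t <? 0ℚ
  ... | no t≮0 = newton 0<q (≮⇒≥ t≮0) t<q²
  ... | yes t<0 with <-dense 0<q
  ...   | p , 0<p , p<q = p , 0<p , p<q , <-trans t<0 (0<* 0<p 0<p)

fromℚ : ℚ → ℝ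
fromℚ c = record
  { L           = _< c
  ; U           = c <_
  ; L-inhabited = c - 1ℚ , p-1<p c
  ; U-inhabited = c + 1ℚ , p<p+1 c
  ; L-lower     = <-trans
  ; U-upper     = λ p<q c<p → <-trans c<p p<q
  ; L-open      = <-dense
  ; U-open      = λ c<q → let p , c<p , p<q = <-dense c<q in p , p<q , c<p
  ; disjoint    = λ (q<c , c<q) → <-asym q<c c<q
  ; located     = loc
  }
  where
  loc : ∀ {p q} → p < q → p < c ⊎ c < q
  loc {p} p<q with p <? c
  ... | yes p<c = inj₁ p<c
  ... | no  p≮c = inj₂ (≤-<-trans (≮⇒≥ p≮c) p<q)

ℕ→ℚ : ℕ → ℚ
ℕ→ℚ k = + k / 1

fromℕ : ℕ → ℝ
fromℕ k = fromℚ (ℕ→ℚ k)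

infixl 6 _⊖_
infixr 7 _·_

-- q < c − x iff x < c − q, so the cuts are exchanged.
_⊖_ : ℚ → ℝ → ℝ
c ⊖ x = record
  { L           = λ q → x.U (c - q)
  ; U           = λ q → x.L (c - q)
  ; L-inhabited = let q , Uq = x.U-inhabited in c - q , subst x.U (sym (c-[c-p]≡p c q)) Uq
  ; U-inhabited = let q , Lq = x.L-inhabited in c - q , subst x.L (sym (c-[c-p]≡p c q)) Lq
  ; L-lower     = λ p<q → x.U-upper (c-antimono c p<q)
  ; U-upper     = λ p<q → x.L-lower (c-antimono c p<q)
  ; L-open      = λ Uq → let p , p<c-q , Up = x.U-open Uq in
                    c - p , c-swapˡ c p<c-q , subst x.U (sym (c-[c-p]≡p c p)) Up
  ; U-open      = λ Lq → let p , c-q<p , Lp = x.L-open Lq in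
                    c - p , c-swapʳ c c-q<p , subst x.L (sym (c-[c-p]≡p c p)) Lp
  ; disjoint    = λ (Uq , Lq) → x.disjoint (Lq , Uq)
  ; located     = λ p<q → swap (x.located (c-antimono c p<q))
  }
  where
  module x = ℝ x

-- The cuts avoid dividing by k, so that k = 0 is allowed.
_·_ : ℕ → ℝ → ℝ
k · x = record
  { L           = λ q → ∃ λ p → x.L p × q < c * p
  ; U           = λ q → ∃ λ p → x.U p × c * p < q
  ; L-inhabited = let p , Lp = x.L-inhabited in c * p - 1ℚ , p , Lp , p-1<p (c * p)
  ; U-inhabited = let p , Up = x.U-inhabited in c * p + 1ℚ , p , Up , p<p+1 (c * p)
  ; L-lower     = λ p<q (a , La , q<ca) → a , La , <-trans p<q q<ca
  ; U-upper     = λ p<q (a , Ua , ca<p) → a , Ua , <-trans ca<p p<q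
  ; L-open      = λ (a , La , q<ca) → let m , q<m , m<ca = <-dense q<ca in
                    m , q<m , a , La , m<ca
  ; U-open      = λ (a , Ua , ca<q) → let m , ca<m , m<q = <-dense ca<q in
                    m , m<q , a , Ua , ca<m
  ; disjoint    = λ ((a , La , q<ca) , (b , Ub , cb<q)) →
                    <-irrefl refl (<-trans (<-≤-trans q<ca
                      (*-monoˡ-≤-nonNeg c {{normalize-nonNeg k 1}} (<⇒≤ (x.L<U La Ub)))) cb<q)
  ; located     = loc k
  }
  where
  module x = ℝ x
  c = ℕ→ℚ k
  loc⁺ : ∀ d → 0ℚ < d → ∀ {p q} → p < q →
         (∃ λ a → x.L a × p < d * a) ⊎ (∃ λ b → x.U b × d * b < q)
  loc⁺ d 0<d {p} {q} p<q with <-dense p<q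
  ... | s , p<s , s<q with <-dense s<q
  ...   | t , s<t , t<q with recip 0<d
  ...     | i , 0<i , d*i≡1 with x.located (*-monoˡ-<-pos i {{positive 0<i}} s<t)
  ...       | inj₁ Lsi = inj₁ (s * i , Lsi , subst (p <_) (sym (*-cancel {d} {i} s d*i≡1)) p<s)
  ...       | inj₂ Uti = inj₂ (t * i , Uti , subst (_< q) (sym (*-cancel {d} {i} t d*i≡1)) t<q)
  loc : ∀ k {p q} → p < q →
        (∃ λ a → x.L a × p < ℕ→ℚ k * a) ⊎ (∃ λ b → x.U b × ℕ→ℚ k * b < q)
  loc zero {p} {q} p<q with p <? 0ℚ
  ... | yes p<0 = let a , La = x.L-inhabited in
                  inj₁ (a , La , subst (p <_) (sym (*-zeroˡ a)) p<0)
  ... | no  p≮0 = let b , Ub = x.U-inhabited in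
                  inj₂ (b , Ub , subst (_< q) (sym (*-zeroˡ b)) (≤-<-trans (≮⇒≥ p≮0) p<q))
  loc (suc k) = loc⁺ (ℕ→ℚ (suc k)) (positive⁻¹ (ℕ→ℚ (suc k)) {{normalize-pos (suc k) 1}})

-- The square root is total: it is 0 at negative arguments.
√_ : ℝ → ℝ
√ x = record
  { L           = λ q → q < 0ℚ ⊎ x.L (q * q)
  ; U           = λ q → 0ℚ < q × x.U (q * q)
  ; L-inhabited = - 1ℚ , inj₁ (negative⁻¹ (- 1ℚ))
  ; U-inhabited = U-inh
  ; L-lower     = lower
  ; U-upper     = λ p<q (0<p , Up²) →
                    <-trans 0<p p<q , x.U-upper (square-mono (<⇒≤ 0<p) p<q) Up²
  ; L-open      = L-op
  ; U-open      = λ (0<q , Uq²) →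
                    let t , t<q² , Ut = x.U-open Uq²
                        p , 0<p , p<q , t<p² = square-openʳ 0<q t<q²
                    in p , p<q , 0<p , x.U-upper t<p² Ut
  ; disjoint    = λ { (inj₁ q<0  , 0<q , _)   → <-asym q<0 0<q
                    ; (inj₂ Lq² , _   , Uq²) → x.disjoint (Lq² , Uq²) }
  ; located     = loc
  }
  where
  module x = ℝ x
  U-inh : ∃ λ q → 0ℚ < q × x.U (q * q)
  U-inh with x.U-inhabited
  ... | b , Ub with 0ℚ <? b
  ...   | no  0≮b = 1ℚ , positive⁻¹ 1ℚ , x.U-upper (≤-<-trans (≮⇒≥ 0≮b) (positive⁻¹ 1ℚ)) Ub
  ...   | yes 0<b = q , 0<q , x.U-upper (<-trans (p<p+1 b) q<q²) Ub
    where
    q = b + 1ℚ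
    0<q : 0ℚ < q
    0<q = <-trans 0<b (p<p+1 b)
    q<q² : q < q * q
    q<q² = subst (_< q * q) (*-identityʳ q)
      (*-monoʳ-<-pos q {{positive 0<q}} (+-monoˡ-< 1ℚ 0<b))
  lower : ∀ {p q} → p < q → q < 0ℚ ⊎ x.L (q * q) → p < 0ℚ ⊎ x.L (p * p)
  lower p<q (inj₁ q<0) = inj₁ (<-trans p<q q<0)
  lower {p} p<q (inj₂ Lq²) with p <? 0ℚ
  ... | yes p<0 = inj₁ p<0
  ... | no  p≮0 = inj₂ (x.L-lower (square-mono (≮⇒≥ p≮0) p<q) Lq²)
  L-op : ∀ {q} → q < 0ℚ ⊎ x.L (q * q) → ∃ λ p → q < p × (p < 0ℚ ⊎ x.L (p * p))
  L-op {q} Lq with q <? 0ℚ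
  L-op {q} Lq | yes q<0 = let p , q<p , p<0 = <-dense q<0 in p , q<p , inj₁ p<0
  L-op {q} (inj₁ q<0) | no q≮0 = ⊥-elim (q≮0 q<0)
  L-op {q} (inj₂ Lq²) | no q≮0 =
    let s , q²<s , Ls = x.L-open Lq²
        r , q<r , r²<s = square-openˡ (≮⇒≥ q≮0) q²<s
    in r , q<r , inj₂ (x.L-lower r²<s Ls)
  loc : ∀ {p q} → p < q → (p < 0ℚ ⊎ x.L (p * p)) ⊎ (0ℚ < q × x.U (q * q))
  loc {p} p<q with p <? 0ℚ
  ... | yes p<0 = inj₁ (inj₁ p<0)
  ... | no  p≮0 with x.located (square-mono (≮⇒≥ p≮0) p<q)
  ...   | inj₁ Lp² = inj₁ (inj₂ Lp²)
  ...   | inj₂ Uq² = inj₂ (≤-<-trans (≮⇒≥ p≮0) p<q , Uq²)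

10⁻³_⁻⁴ : (n : ℕ) .{{_ : ℕ.NonZero n}} → ℚ
10⁻³ n ⁻⁴ = _/_ (+ 1) (10 ℕ.^ 3 ℕ.* n ℕ.^ 4) {{ℕ.m*n≢0 (10 ℕ.^ 3) (n ℕ.^ 4) {{_}} {{ℕ.m^n≢0 n 4}}}}

module Submission where

open import Defs
open import Algebra.Properties.CommutativeSemigroup using (interchange)
open import Data.Bool.Base using (Bool; true; false; not; _∧_; if_then_else_)
import Data.Bool.Properties as Bool
open import Data.Empty using (⊥; ⊥-elim)
open import Data.Fin.Base using (Fin; zero; suc; toℕ; fromℕ<; inject≤)
open import Data.Fin.Properties using (any?; toℕ-fromℕ<; toℕ-injective; toℕ<n; toℕ-inject≤; inject≤-injective)
  renaming (suc-injective to Fin-suc-injective; _≟_ to _≟ᶠ_)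
open import Data.Fin.Subset using (Subset; inside; outside; _∈_; _∩_; _⊆_; _-_; Nonempty; ∣_∣; ⊤; ⁅_⁆)
open import Data.Fin.Subset.Properties
  using (_∈?_; ⊆-antisym; x∈p∩q⁻; x∈p∧x≢y⇒x∈p-y; p─q⊆p; p─⊥≡p; ∈⊤; ∣⊤∣≡n; ∣⁅x⁆∣≡1; x∈⁅x⁆; x∈⁅y⁆⇒x≡y)
import Data.Integer.Base as ℤ
import Data.Integer.Properties as ℤ
open import Data.List.Base as List using (List; []; _∷_; _++_; length; map; filter; concatMap; allFin)
import Data.List.Membership.DecPropositional as DecMembership
open import Data.List.Membership.Propositional using (lose; find) renaming (_∈_ to _∈ᴸ_)
open import Data.List.Membership.Propositional.Properties
  using (∈-∃++; ∈-map⁺; ∈-map⁻; ∈-concatMap⁺; ∈-concatMap⁻; ∈-filter⁺; ∈-filter⁻; ∈-tabulate⁻; ∈-allFin)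
open import Data.List.Properties using (length-map; length-++; length-tabulate; map-∘)
open import Data.List.Relation.Binary.Permutation.Propositional
  using (_↭_; ↭-refl; ↭-sym; ↭-trans; ↭-reflexive; prep; swap)
open import Data.List.Relation.Binary.Permutation.Propositional.Properties
  using (shift; ∈-resp-↭; ↭-length; drop-∷; map⁺)
open import Data.List.Relation.Unary.All as All using ()
open import Data.List.Relation.Unary.AllPairs using ([]; _∷_)
open import Data.List.Relation.Unary.Any using (here; there)
open import Data.List.Relation.Unary.Unique.Propositional using (Unique)
open import Data.List.Relation.Unary.Unique.Propositional.Properties using (filter⁺; tabulate⁺)
  renaming (map⁺ to Unique-map⁺; ++⁺ to Unique-++⁺; allFin⁺ to Unique-allFin)
open import Data.Nat using (ℕ; zero; suc; _+_; _*_; _∸_; _^_; _/_; _%_; _!; _≤_; _<_; _<ᵇ_; z≤n; s≤s; s≤s⁻¹; NonZero; >-nonZero)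
open import Data.Nat.Combinatorics using (_C_; nCk≡n!/k![n-k]!; k![n∸k]!∣n!)
open import Data.Nat.DivMod using (m/n*n≡m; m≡m%n+[m/n]*n; m%n<n; m<n⇒m%n≡m; [m+n]%n≡m%n; %-distribˡ-+; m%n%n≡m%n)
open import Data.Nat.ListAction using (sum)
open import Data.Nat.ListAction.Properties using (sum-↭)
open import Data.Nat.Properties
open import Data.Nat.Solver using (module +-*-Solver)
open import Data.Product using (∃; ∃₂; _×_; _,_; proj₁; proj₂)
open import Data.Rational using (0ℚ; 1ℚ)
import Data.Rational as ℚ
import Data.Rational.Properties as ℚ
import Data.Rational.Solver as ℚ
import Data.Rational.Unnormalised as ℚᵘ
import Data.Rational.Unnormalised.Properties as ℚᵘ
open import Data.Sum using (_⊎_; inj₁; inj₂)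
open import Data.Vec.Base using (Vec; []; _∷_; lookup; tabulate; toList; here; there)
open import Data.Vec.Properties
  using (lookup∘tabulate; tabulate∘lookup; tabulate-cong; []=⇒lookup; lookup⇒[]=; ≡-dec; ∷-injectiveˡ; ∷-injectiveʳ)
open import Function using (_∘_; id)
open import Relation.Binary.PropositionalEquality
  using (_≡_; _≢_; refl; sym; trans; cong; cong₂; subst; subst₂; module ≡-Reasoning)
open import Relation.Nullary using (Dec; does; yes; no; _×-dec_; ¬_; ¬?)
open import Relation.Nullary.Decidable using (dec-true; dec-false)
open import Relation.Unary using (Decidable)

-- Katona's circle: place the n vertices on a circle according to a permutation w. As 2r < n, at most r of the n arcs
-- of length r are edges, and if exactly r are, they are the arcs through one point, so that the edges point out a
-- vertex. With d = C(n-1,r-1) - |G| missing edges, all but a fraction O(rd / C(n-1,r-1)) of the permutations are of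
-- this kind. If such a w is changed by an adjacent transposition that fixes the vertex pointed out, the result
-- either points out the same vertex or is exceptional. As at most n² adjacent transpositions join any two permutations
-- with v in front, for each v the permutations pointing out v are nearly all or nearly none of those with v in front;
-- it cannot be nearly none for every v. If it is nearly all, only O(n²rd) edges through v are missing from G.

-- Few exceptional words alone give no dichotomy: the other words might be shared evenly among many
-- vertices. The remedy is to keep v in front, where pointing out v becomes the single condition
-- `h 0`, and to count pairs. Let q words with v in front satisfy it and q' fail it. The two words
-- of a pair differ by a permutation of the other positions, and on a path of adjacent
-- transpositions from the first to the second some step loses the condition and so enters an
-- exceptional word. With m = n - 1 and β exceptional words that have v in front, this gives q q' ≤
-- m! m² β; as q + q' = m!, the smaller of the two is at most 2m²β. Not every q is small, because
-- each word that is not exceptional has a rotation that puts the vertex it points out in front.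
--
-- The bound n³d obtained for the edges avoiding v is linear in d, while the theorem asks for a
-- square root. The hypothesis on δ reconciles them: with c = C(n-1,r-1) it yields n⁴d < c, so
-- (n³d)² ≤ n²cd, and d < cδ.

private variable
  A A′ : Set
  k N : ℕ

-- Pigeonhole for lists; finite sums

unique-⊆⇒↭ : {xs ys : List A} → Unique xs → (∀ {x} → x ∈ᴸ xs → x ∈ᴸ ys) →
              length ys ≤ length xs → xs ↭ ys
unique-⊆⇒↭ {xs = []}     {ys = []} _ _ _ = ↭-refl
unique-⊆⇒↭ {xs = x ∷ xs} {ys} (x∉xs ∷ uxs) xs⊆ys len
  with as , bs , refl ← ∈-∃++ (xs⊆ys (here refl)) =
  ↭-trans (prep x (unique-⊆⇒↭ uxs xs⊆as++bs len′)) (↭-sym (shift x as bs))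
  where
  xs⊆as++bs : ∀ {y} → y ∈ᴸ xs → y ∈ᴸ as ++ bs
  xs⊆as++bs y∈xs with ∈-resp-↭ (shift x as bs) (xs⊆ys (there y∈xs))
  ... | here refl = ⊥-elim (All.lookup x∉xs y∈xs refl)
  ... | there y∈  = y∈
  len′ : length (as ++ bs) ≤ length xs
  len′ = s≤s⁻¹ (subst (_≤ suc (length xs)) (↭-length (shift x as bs)) len)

-- The image has as many entries as the list, so pigeonhole leaves nothing out. All later changes of
-- summation variable, by rotation, transposition or left multiplication, go through this.
injective-↭ : {f : A → A} {xs : List A} → Unique xs → (∀ {x y} → f x ≡ f y → x ≡ y) →
              (∀ {x} → x ∈ᴸ xs → f x ∈ᴸ xs) → map f xs ↭ xs
injective-↭ {f = f} {xs} u inj closed =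
  unique-⊆⇒↭ (Unique-map⁺ inj u) sub (≤-reflexive (sym (length-map f xs)))
  where
  sub : ∀ {y} → y ∈ᴸ map f xs → y ∈ᴸ xs
  sub y∈ with x , x∈xs , refl ← ∈-map⁻ f y∈ = closed x∈xs

unique-length : {xs ys : List A} → Unique xs → Unique ys →
                (∀ {x} → x ∈ᴸ xs → x ∈ᴸ ys) → (∀ {x} → x ∈ᴸ ys → x ∈ᴸ xs) → length xs ≡ length ys
unique-length {xs = xs} {ys} ux uy to from with ≤-total (length ys) (length xs)
... | inj₁ le = ↭-length (unique-⊆⇒↭ ux to le)
... | inj₂ le = sym (↭-length (unique-⊆⇒↭ uy from le))

𝟙 : Bool → ℕ
𝟙 true  = 1
𝟙 false = 0

𝟙≤1 : ∀ b → 𝟙 b ≤ 1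
𝟙≤1 true  = ≤-refl
𝟙≤1 false = z≤n

𝟙-not : ∀ b → 𝟙 b + 𝟙 (not b) ≡ 1
𝟙-not true  = refl
𝟙-not false = refl

∑ : List A → (A → ℕ) → ℕ
∑ xs f = sum (map f xs)

∑-cong-∈ : (xs : List A) {f g : A → ℕ} → (∀ {x} → x ∈ᴸ xs → f x ≡ g x) → ∑ xs f ≡ ∑ xs g
∑-cong-∈ []       eq = refl
∑-cong-∈ (x ∷ xs) eq = cong₂ _+_ (eq (here refl)) (∑-cong-∈ xs (eq ∘ there))

∑-cong : (xs : List A) {f g : A → ℕ} → (∀ x → f x ≡ g x) → ∑ xs f ≡ ∑ xs g
∑-cong xs eq = ∑-cong-∈ xs λ {x} _ → eq x

∑-mono-∈ : (xs : List A) {f g : A → ℕ} → (∀ {x} → x ∈ᴸ xs → f x ≤ g x) → ∑ xs f ≤ ∑ xs g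
∑-mono-∈ []       le = z≤n
∑-mono-∈ (x ∷ xs) le = +-mono-≤ (le (here refl)) (∑-mono-∈ xs (le ∘ there))

∑-+ : (xs : List A) (f g : A → ℕ) → ∑ xs (λ x → f x + g x) ≡ ∑ xs f + ∑ xs g
∑-+ []       f g = refl
∑-+ (x ∷ xs) f g = trans (cong (f x + g x +_) (∑-+ xs f g)) (interchange +-commutativeSemigroup (f x) (g x) _ _)

∑-*ˡ : (xs : List A) (c : ℕ) (f : A → ℕ) → ∑ xs (λ x → c * f x) ≡ c * ∑ xs f
∑-*ˡ []       c f = sym (*-zeroʳ c)
∑-*ˡ (x ∷ xs) c f = trans (cong (c * f x +_) (∑-*ˡ xs c f)) (sym (*-distribˡ-+ c (f x) _))

∑-*ʳ : (xs : List A) (f : A → ℕ) (c : ℕ) → ∑ xs (λ x → f x * c) ≡ ∑ xs f * c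
∑-*ʳ xs f c = trans (∑-cong xs λ x → *-comm (f x) c) (trans (∑-*ˡ xs c f) (*-comm c _))

∑-const : (xs : List A) (c : ℕ) → ∑ xs (λ _ → c) ≡ length xs * c
∑-const []       c = refl
∑-const (x ∷ xs) c = cong (c +_) (∑-const xs c)

∑-swap : (xs : List A) (ys : List A′) (f : A → A′ → ℕ) →
         ∑ xs (λ x → ∑ ys (f x)) ≡ ∑ ys (λ y → ∑ xs (λ x → f x y))
∑-swap []       ys f = sym (trans (∑-const ys 0) (*-zeroʳ (length ys)))
∑-swap (x ∷ xs) ys f = trans (cong (∑ ys (f x) +_) (∑-swap xs ys f)) (sym (∑-+ ys (f x) _))

∑-injective : {f : A → A} {xs : List A} → Unique xs → (∀ {x y} → f x ≡ f y → x ≡ y) →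
              (∀ {x} → x ∈ᴸ xs → f x ∈ᴸ xs) → (φ : A → ℕ) → ∑ xs (φ ∘ f) ≡ ∑ xs φ
∑-injective {f = f} {xs} u inj closed φ =
  trans (cong sum (map-∘ xs)) (sum-↭ (map⁺ φ (injective-↭ u inj closed)))

∑-filter : {P : A → Set} (P? : Decidable P) (xs : List A) →
           ∑ xs (λ x → 𝟙 (does (P? x))) ≡ length (filter P? xs)
∑-filter P? []       = refl
∑-filter P? (x ∷ xs) with does (P? x)
... | true  = cong suc (∑-filter P? xs)
... | false = ∑-filter P? xs

∑-𝟙≡ : {P : A → Set} (P? : Decidable P) {x : A} (xs : List A) → Unique xs → x ∈ᴸ xs →
       P x → (∀ {y} → P y → y ≡ x) → ∑ xs (λ y → 𝟙 (does (P? y))) ≡ 1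
∑-𝟙≡ {P = P} P? {x} xs uxs x∈xs Px only = trans (∑-filter P? xs) (go xs uxs x∈xs)
  where
  none : ∀ ys → (∀ {y} → y ∈ᴸ ys → x ≢ y) → length (filter P? ys) ≡ 0
  none []       _ = refl
  none (y ∷ ys) x∉ with P? y
  ... | yes Py = ⊥-elim (x∉ (here refl) (sym (only Py)))
  ... | no  _  = none ys (x∉ ∘ there)
  go : ∀ ys → Unique ys → x ∈ᴸ ys → length (filter P? ys) ≡ 1
  go (y ∷ ys) (y∉ ∷ u) y∈ with P? y
  go (y ∷ ys) (y∉ ∷ u) _ | yes Py with refl ← only Py = cong suc (none ys λ z∈ → All.lookup y∉ z∈)
  go (y ∷ ys) (y∉ ∷ u) (here refl) | no ¬Py = ⊥-elim (¬Py Px)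
  go (y ∷ ys) (y∉ ∷ u) (there x∈)  | no ¬Py = go ys u x∈

∑< : ℕ → (ℕ → ℕ) → ℕ
∑< zero    f = 0
∑< (suc n) f = f 0 + ∑< n (f ∘ suc)

∑<-cong : ∀ n {f g} → (∀ {i} → i < n → f i ≡ g i) → ∑< n f ≡ ∑< n g
∑<-cong zero    eq = refl
∑<-cong (suc n) eq = cong₂ _+_ (eq (s≤s z≤n)) (∑<-cong n (eq ∘ s≤s))

∑<-mono : ∀ n {f g} → (∀ {i} → i < n → f i ≤ g i) → ∑< n f ≤ ∑< n g
∑<-mono zero    le = z≤n
∑<-mono (suc n) le = +-mono-≤ (le (s≤s z≤n)) (∑<-mono n (le ∘ s≤s))

∑<-const : ∀ n c → ∑< n (λ _ → c) ≡ n * c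
∑<-const zero    c = refl
∑<-const (suc n) c = cong (c +_) (∑<-const n c)

∑<-+ : ∀ n f g → ∑< n (λ i → f i + g i) ≡ ∑< n f + ∑< n g
∑<-+ zero    f g = refl
∑<-+ (suc n) f g = trans (cong (f 0 + g 0 +_) (∑<-+ n _ _)) (interchange +-commutativeSemigroup (f 0) (g 0) _ _)

∑<-split : ∀ m n f → ∑< (m + n) f ≡ ∑< m f + ∑< n (λ i → f (m + i))
∑<-split zero    n f = refl
∑<-split (suc m) n f = trans (cong (f 0 +_) (∑<-split m n (f ∘ suc))) (sym (+-assoc (f 0) _ _))

∑<-last : ∀ n f → ∑< (suc n) f ≡ ∑< n f + f n
∑<-last zero    f = +-identityʳ (f 0)
∑<-last (suc n) f = trans (cong (f 0 +_) (∑<-last n (f ∘ suc))) (sym (+-assoc (f 0) _ _))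

∑<-swap : (xs : List A) (n : ℕ) (f : A → ℕ → ℕ) →
          ∑ xs (λ x → ∑< n (f x)) ≡ ∑< n (λ i → ∑ xs (λ x → f x i))
∑<-swap xs zero    f = trans (∑-const xs 0) (*-zeroʳ (length xs))
∑<-swap xs (suc n) f = trans (∑-+ xs _ _) (cong (∑ xs (λ x → f x 0) +_) (∑<-swap xs n λ x → f x ∘ suc))

-- Moving the start by one drops the term at p and adds the one at p + n, which is equal by
-- periodicity.
∑<-rotate : ∀ n f → (∀ i → f (i + n) ≡ f i) → ∀ p → ∑< n (λ i → f (p + i)) ≡ ∑< n f
∑<-rotate n f per zero    = refl
∑<-rotate n f per (suc p) = trans step
                                  (∑<-rotate n f per p)
  where
  step : ∑< n (λ i → f (suc p + i)) ≡ ∑< n (λ i → f (p + i))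
  step = +-cancelˡ-≡ (f (p + 0)) _ _ (trans
    (cong (f (p + 0) +_) (∑<-cong n λ {i} _ → cong f (sym (+-suc p i))))
    (trans (∑<-last n (f ∘ (p +_)))
      (trans (+-comm _ (f (p + n))) (cong (_+ ∑< n (f ∘ (p +_))) (trans (per p) (cong f (sym (+-identityʳ p))))))))

∑<-zero⊎witness : ∀ n (B : ℕ → Bool) → ∑< n (𝟙 ∘ B) ≡ 0 ⊎ ∃ λ i → i < n × B i ≡ true
∑<-zero⊎witness zero    B = inj₁ refl
∑<-zero⊎witness (suc n) B with B 0 in B0
... | true  = inj₂ (0 , s≤s z≤n , B0)
... | false with ∑<-zero⊎witness n (B ∘ suc)
...   | inj₁ eq            = inj₁ eq
...   | inj₂ (i , i<n , e) = inj₂ (suc i , s≤s i<n , e)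

∑<-member : ∀ n f {i} → i < n → f i ≤ ∑< n f
∑<-member (suc n) f {zero}  _        = m≤m+n (f 0) _
∑<-member (suc n) f {suc i} (s≤s lt) = ≤-trans (∑<-member n (f ∘ suc) lt) (m≤n+m _ (f 0))

-- Counting injective words with prescribed sets of letters

x∉p-x : ∀ (p : Subset N) x {y} → y ∈ p - x → y ≢ x
x∉p-x (_ ∷ p) zero    () refl
x∉p-x (_ ∷ p) (suc x) (there y∈) refl = x∉p-x p x y∈ refl

∣p-x∣ : ∀ {p : Subset N} {x} → x ∈ p → suc ∣ p - x ∣ ≡ ∣ p ∣
∣p-x∣ {p = inside ∷ p}  here       = cong (suc ∘ ∣_∣) (p─⊥≡p p)
∣p-x∣ {p = inside ∷ p}  (there x∈) = cong suc (∣p-x∣ x∈)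
∣p-x∣ {p = outside ∷ p} (there x∈) = ∣p-x∣ x∈

elements : Subset N → List (Fin N)
elements []            = []
elements (inside  ∷ p) = zero ∷ map suc (elements p)
elements (outside ∷ p) = map suc (elements p)

length-elements : (p : Subset N) → length (elements p) ≡ ∣ p ∣
length-elements []            = refl
length-elements (inside  ∷ p) = cong suc (trans (length-map suc (elements p)) (length-elements p))
length-elements (outside ∷ p) = trans (length-map suc (elements p)) (length-elements p)

∈-elements⁺ : ∀ {p : Subset N} {x} → x ∈ p → x ∈ᴸ elements p
∈-elements⁺ {p = inside  ∷ p} here       = here refl
∈-elements⁺ {p = inside  ∷ p} (there x∈) = there (∈-map⁺ suc (∈-elements⁺ x∈))
∈-elements⁺ {p = outside ∷ p} (there x∈) = ∈-map⁺ suc (∈-elements⁺ x∈)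

∈-elements⁻ : ∀ (p : Subset N) {x} → x ∈ᴸ elements p → x ∈ p
∈-elements⁻ (inside  ∷ p) (here refl) = here
∈-elements⁻ (inside  ∷ p) (there x∈) with y , y∈ , refl ← ∈-map⁻ suc x∈ = there (∈-elements⁻ p y∈)
∈-elements⁻ (outside ∷ p) x∈         with y , y∈ , refl ← ∈-map⁻ suc x∈ = there (∈-elements⁻ p y∈)

unique-elements : (p : Subset N) → Unique (elements p)
unique-elements []            = []
unique-elements (inside  ∷ p) =
  All.tabulate (λ y∈ 0≡y → 0∉ (subst (_∈ᴸ map suc (elements p)) (sym 0≡y) y∈)) ∷ Unique-map⁺ Fin-suc-injective (unique-elements p)
  where
  0∉ : ¬ (zero ∈ᴸ map suc (elements p))
  0∉ 0∈ with () ← proj₂ (proj₂ (∈-map⁻ suc 0∈))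
unique-elements (outside ∷ p) = Unique-map⁺ Fin-suc-injective (unique-elements p)

Injective : ∀ {k} → Vec (Fin N) k → Set
Injective w = ∀ {i j} → lookup w i ≡ lookup w j → i ≡ j

_∈∏_ : ∀ {k} → Vec (Fin N) k → (ℕ → Subset N) → Set
w ∈∏ T = ∀ i → lookup w i ∈ T (toℕ i)

remaining : (ℕ → Subset N) → Fin N → ℕ → Subset N
remaining T a i = T (suc i) - a

-- Each chosen letter is removed from all later sets, so injectivity is built in and the length can
-- be computed as a product.
words : ∀ k → (ℕ → Subset N) → List (Vec (Fin N) k)
words zero    T = [] ∷ []
words (suc k) T = concatMap (λ a → map (a ∷_) (words k (remaining T a))) (elements (T 0))

∈-words⁻ : ∀ k (T : ℕ → Subset N) {w} → w ∈ᴸ words k T → w ∈∏ T × Injective w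
∈-words⁻ zero    T {[]} _ = (λ ()) , λ { {()} }
∈-words⁻ (suc k) T w∈
  with a , a∈ , w∈′ ← find (∈-concatMap⁻ (λ a → map (a ∷_) (words k (remaining T a))) {xs = elements (T 0)} w∈)
  with w , w∈ , refl ← ∈-map⁻ (a ∷_) w∈′
  with w∈∏ , inj ← ∈-words⁻ k (remaining T a) w∈ = w∈T , inj′
  where
  w∈T : (a ∷ w) ∈∏ T
  w∈T zero    = ∈-elements⁻ (T 0) a∈
  w∈T (suc i) = p─q⊆p (T (suc (toℕ i))) ⁅ a ⁆ (w∈∏ i)
  inj′ : Injective (a ∷ w)
  inj′ {zero}  {zero}  _  = refl
  inj′ {zero}  {suc j} eq = ⊥-elim (x∉p-x (T (suc (toℕ j))) a (w∈∏ j) (sym eq))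
  inj′ {suc i} {zero}  eq = ⊥-elim (x∉p-x (T (suc (toℕ i))) a (w∈∏ i) eq)
  inj′ {suc i} {suc j} eq = cong suc (inj eq)

∈-words⁺ : ∀ k (T : ℕ → Subset N) {w} → w ∈∏ T → Injective w → w ∈ᴸ words k T
∈-words⁺ zero    T {[]}    _   _   = here refl
∈-words⁺ (suc k) T {a ∷ w} w∈T inj =
  ∈-concatMap⁺ _ (lose (∈-elements⁺ (w∈T zero)) (∈-map⁺ (a ∷_)
    (∈-words⁺ k _ (λ i → x∈p∧x≢y⇒x∈p-y (w∈T (suc i)) λ eq → 1+i≢0 (inj {suc i} {zero} eq))
      λ eq → Fin-suc-injective (inj eq))))
  where
  1+i≢0 : ∀ {k} {i : Fin k} → Fin.suc i ≢ zero
  1+i≢0 ()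

unique-words : ∀ k (T : ℕ → Subset N) → Unique (words k T)
unique-words zero    T = All.tabulate (λ ()) ∷ []
unique-words (suc k) T = go (elements (T 0)) (unique-elements (T 0))
  where
  f = λ a → map (a ∷_) (words k (remaining T a))
  go : ∀ as → Unique as → Unique (concatMap f as)
  go []       _         = []
  go (a ∷ as) (a∉ ∷ u) = Unique-++⁺ (Unique-map⁺ ∷-injectiveʳ (unique-words k _)) (go as u) disj
    where
    disj : ∀ {w} → w ∈ᴸ f a × w ∈ᴸ concatMap f as → _
    disj (w∈ , w∈′) with b , b∈ , w∈″ ← find (∈-concatMap⁻ f {xs = as} w∈′)
      with _ , _ , refl ← ∈-map⁻ (a ∷_) w∈ with _ , _ , eq ← ∈-map⁻ (b ∷_) w∈″ =
      All.lookup a∉ b∈ (∷-injectiveˡ eq)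

-- The product of all `c i ∸ i`: each choice takes one letter away from every later set.
falling : ℕ → (ℕ → ℕ) → ℕ
falling zero    c = 1
falling (suc k) c = c 0 * falling k (λ i → c (suc i) ∸ 1)

falling-cong : ∀ k {c d} → (∀ i → c i ≡ d i) → falling k c ≡ falling k d
falling-cong zero    eq = refl
falling-cong (suc k) eq = cong₂ _*_ (eq 0) (falling-cong k λ i → cong (_∸ 1) (eq (suc i)))

falling-const : ∀ m → falling m (λ _ → m) ≡ m !
falling-const zero    = refl
falling-const (suc m) = cong (suc m *_) (falling-const m)

-- The sizes are those for words whose first r letters lie in a fixed r-set: r! orders inside it and
-- m! for the rest. Lowering the step function by one gives the step function for r - 1.
falling-step : ∀ r m → falling (r + m) (λ i → if i <ᵇ r then r else r + m) ≡ r ! * m !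
falling-step zero    m = trans (falling-const m) (sym (*-identityˡ (m !)))
falling-step (suc r) m = trans
  (cong (suc r *_) (trans (falling-cong (r + m) λ i → pred-if (i <ᵇ r)) (falling-step r m)))
  (sym (*-assoc (suc r) (r !) (m !)))
  where
  pred-if : ∀ b → (if b then suc r else suc r + m) ∸ 1 ≡ (if b then r else r + m)
  pred-if true  = refl
  pred-if false = refl

-- As the sets increase, the first letter belongs to all later ones. Each of them therefore shrinks
-- by exactly one, whichever letter was chosen.
length-words : ∀ k (T : ℕ → Subset N) → (∀ i {x} → x ∈ T i → x ∈ T (suc i)) →
               length (words k T) ≡ falling k (∣_∣ ∘ T)
length-words zero    T mono = refl
length-words (suc k) T mono = trans (go (elements (T 0)) (∈-elements⁻ (T 0)))
  (cong (_* falling k (λ i → ∣ T (suc i) ∣ ∸ 1)) (length-elements (T 0)))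
  where
  f = λ a → map (a ∷_) (words k (remaining T a))
  T0⊆ : ∀ i {x} → x ∈ T 0 → x ∈ T i
  T0⊆ zero    x∈ = x∈
  T0⊆ (suc i) x∈ = mono i (T0⊆ i x∈)
  one : ∀ {a} → a ∈ T 0 → length (f a) ≡ falling k (λ i → ∣ T (suc i) ∣ ∸ 1)
  one {a} a∈ = trans (length-map (a ∷_) (words k (remaining T a)))
    (trans (length-words k (remaining T a) λ i x∈ →
        x∈p∧x≢y⇒x∈p-y (mono (suc i) (p─q⊆p (T (suc i)) ⁅ a ⁆ x∈)) (x∉p-x (T (suc i)) a x∈))
      (falling-cong k λ i → cong (_∸ 1) (∣p-x∣ (T0⊆ (suc i) a∈))))
  go : ∀ as → (∀ {a} → a ∈ᴸ as → a ∈ T 0) →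
       length (concatMap f as) ≡ length as * falling k (λ i → ∣ T (suc i) ∣ ∸ 1)
  go []       _  = refl
  go (a ∷ as) ⊆T = trans (length-++ (f a)) (cong₂ _+_ (one (⊆T (here refl))) (go as (⊆T ∘ there)))

-- Katona's cycle lemma with its case of equality

𝟙-disjoint : ∀ {a b} → (a ≡ true → b ≡ true → ⊥) → 𝟙 a + 𝟙 b ≤ 1
𝟙-disjoint {true}  {true}  ¬both = ⊥-elim (¬both refl refl)
𝟙-disjoint {true}  {false} _     = ≤-refl
𝟙-disjoint {false} {b}     _     = 𝟙≤1 b

pairing-≤ : ∀ r (x y : ℕ → Bool) → (∀ k → k < r → x k ≡ true → y k ≡ true → ⊥) →
            ∑< r (λ k → 𝟙 (x k) + 𝟙 (y k)) ≤ r
pairing-≤ r x y ¬both = ≤-trans (∑<-mono r λ {k} k<r → 𝟙-disjoint (¬both k k<r))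
  (≤-reflexive (trans (∑<-const r 1) (*-identityʳ r)))

-- In the order x 0, y 0, x 1, y 1, ... no two neighbours are both true. If every pair contributes
-- 1, the false last y forces the last x, this excludes the y before it, and so on down to x 0.
pairing-full : ∀ r (x y : ℕ → Bool) → (∀ k → k < r → x k ≡ true → y k ≡ true → ⊥) →
               (∀ k → suc k < r → x (suc k) ≡ true → y k ≡ true → ⊥) →
               (∀ k → suc k ≡ r → y k ≡ false) →
               ∑< r (λ k → 𝟙 (x k) + 𝟙 (y k)) < r ⊎ (∀ k → k < r → x k ≡ true)
pairing-full zero x y _ _ _ = inj₂ λ _ ()
pairing-full (suc zero) x y _ _ last with x 0 in x0 | y 0 | last 0 refl
... | true  | _ | _    = inj₂ λ { zero _ → x0 ; (suc _) (s≤s ()) }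
... | false | _ | refl = inj₁ ≤-refl
pairing-full (suc (suc r)) x y ¬both ¬next last
  with pairing-full (suc r) (x ∘ suc) (y ∘ suc) (λ k lt → ¬both (suc k) (s≤s lt))
         (λ k lt → ¬next (suc k) (s≤s lt)) (λ k eq → last (suc k) (cong suc eq))
... | inj₁ lt = inj₁ (+-mono-≤-< (𝟙-disjoint {x 0} {y 0} (¬both 0 (s≤s z≤n))) lt)
... | inj₂ all with x 0 in x0 | y 0 in y0
...   | true  | _     = inj₂ λ { zero _ → x0 ; (suc k) (s≤s lt) → all k lt }
...   | false | true  = ⊥-elim (¬next 0 (s≤s (s≤s z≤n)) (all 0 (s≤s z≤n)) y0)
...   | false | false = inj₁ (s≤s (pairing-≤ (suc r) (x ∘ suc) (y ∘ suc) λ k lt → ¬both (suc k) (s≤s lt)))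

rising : ∀ k (f : ℕ → Bool) → f 0 ≡ false → f k ≡ true → ∃ λ i → f i ≡ false × f (suc i) ≡ true
rising zero    f f0 fk with () ← trans (sym f0) fk
rising (suc k) f f0 fk with f k in eq
... | false = k , eq , fk
... | true  = rising k f f0 eq

-- The arcs are abstracted to a periodic sequence: `B i` will mean that arc i is an edge, and `far`
-- keeps from the intersection property only that disjoint arcs are not both edges.
module Cyclic (m r : ℕ) (1≤r : 1 ≤ r) (2r<n : 2 * r < suc m) (B : ℕ → Bool)
  (periodic : ∀ i → B (i + suc m) ≡ B i)
  (far : ∀ i d → r ≤ d → d + r ≤ suc m → B i ≡ true → B (i + d) ≡ true → ⊥) where

  private
    n : ℕ
    n = suc m

  Window : ℕ → Set
  Window p = ∀ i → i < r → B (p + i) ≡ true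

  private
    g = n ∸ 2 * r

    n≡ : n ≡ r + (g + r)
    n≡ = trans (sym (m+[n∸m]≡n (<⇒≤ 2r<n)))
      (solve 2 (λ r g → con 2 :* r :+ g := r :+ (g :+ r)) refl r g)
      where open +-*-Solver

    1≤g : 1 ≤ g
    1≤g = m<n⇒0<n∸m 2r<n

    periodic* : ∀ k i → B (i + k * n) ≡ B i
    periodic* zero    i = cong B (+-identityʳ i)
    periodic* (suc k) i = trans (cong B (sym (+-assoc i n (k * n)))) (trans (periodic* k (i + n)) (periodic i))

    -- From a true value, the value r later is false by `far` and the value n later is true again,
    -- so the sequence rises in between.
    edge : ∀ {i} → B i ≡ true → ∃ λ p → B p ≡ false × B (suc p) ≡ true
    edge {i} Bi with rising (g + r) (λ k → B (i + r + k))
      (Bool.¬-not λ e → far i r ≤-refl (subst (r + r ≤_) (sym n≡) (+-monoʳ-≤ r (m≤n+m r g)))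
        Bi (trans (cong B (sym (+-identityʳ (i + r)))) e))
      (trans (cong B (trans (+-assoc i r (g + r)) (cong (i +_) (sym n≡)))) (trans (periodic i) Bi))
    ... | k , e₁ , e₂ = i + r + k , e₁ , trans (cong B (sym (+-suc (i + r) k))) e₂

    module Edge {p} (¬Bp : B p ≡ false) where
      D : ℕ → Bool
      D k = B (suc p + k)

      D-far : ∀ {i j} d → j ≡ i + d → r ≤ d → d + r ≤ n → D i ≡ true → D j ≡ true → ⊥
      D-far {i} d refl r≤d d+r≤n Di Dj =
        far (suc p + i) d r≤d d+r≤n Di (trans (cong B (+-assoc (suc p) i d)) Dj)

      -- The turn that begins at the rise consists of r values `x`, a middle of length g and r
      -- values `y`. The middle is excluded by `D 0`. The distance from `x k` to `y k` is r + g,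
      -- that from `x (suc k)` to `y k` is one less and still at least r, because 2r < n makes g
      -- positive. The last `y` is the false value just before the rise, one period later.
      x y : ℕ → Bool
      x = D
      y k = D (r + (g + k))

      d₁+r≤n : r + g + r ≤ n
      d₁+r≤n = ≤-reflexive (trans (+-assoc r g r) (sym n≡))

      ¬both : ∀ k → k < r → x k ≡ true → y k ≡ true → ⊥
      ¬both k _ = D-far (r + g) (trans (sym (+-assoc r g k)) (+-comm (r + g) k)) (m≤m+n r g) d₁+r≤n

      ¬next : ∀ k → suc k < r → x (suc k) ≡ true → y k ≡ true → ⊥
      ¬next k _ = D-far (r + (g ∸ 1)) eq (m≤m+n r (g ∸ 1))
        (≤-trans (+-monoˡ-≤ r (+-monoʳ-≤ r (m∸n≤m g 1))) d₁+r≤n)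
        where
        open +-*-Solver
        eq : r + (g + k) ≡ suc k + (r + (g ∸ 1))
        eq = trans (cong (λ z → r + (z + k)) (sym (m+[n∸m]≡n 1≤g)))
          (solve 3 (λ r k h → r :+ (con 1 :+ h :+ k) := con 1 :+ k :+ (r :+ h)) refl r k (g ∸ 1))

      last : ∀ k → suc k ≡ r → y k ≡ false
      last k eq = trans (cong B eq′) (trans (periodic p) ¬Bp)
        where
        open +-*-Solver
        eq′ : suc p + (r + (g + k)) ≡ p + n
        eq′ = trans (solve 4 (λ p r g k → con 1 :+ p :+ (r :+ (g :+ k)) := p :+ (r :+ (g :+ (con 1 :+ k)))) refl p r g k)
          (cong (p +_) (trans (cong (λ z → r + (g + z)) eq) (sym n≡)))

      middle : ∑< g (λ k → 𝟙 (D (r + k))) ≡ 0 ⊎ D 0 ≡ false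
      middle with D 0 in D0
      ... | false = inj₂ refl
      ... | true  = inj₁ (trans (∑<-cong g λ {k} k<g → cong 𝟙 (Bool.¬-not λ e →
          D-far {0} {r + k} (r + k) refl (m≤m+n r k)
            (≤-trans (+-monoˡ-≤ r (+-monoʳ-≤ r (<⇒≤ k<g))) d₁+r≤n) D0 e))
          (trans (∑<-const g 0) (*-zeroʳ g)))

      sum≡ : D 0 ≡ true → ∑< n (𝟙 ∘ B) ≡ ∑< r (λ k → 𝟙 (x k) + 𝟙 (y k))
      sum≡ D0 = begin
        ∑< n (𝟙 ∘ B)
          ≡⟨ ∑<-rotate n (𝟙 ∘ B) (cong 𝟙 ∘ periodic) (suc p) ⟨
        ∑< n (𝟙 ∘ D)
          ≡⟨ cong (λ z → ∑< z (𝟙 ∘ D)) n≡ ⟩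
        ∑< (r + (g + r)) (𝟙 ∘ D)
          ≡⟨ ∑<-split r (g + r) (𝟙 ∘ D) ⟩
        ∑< r (𝟙 ∘ x) + ∑< (g + r) (λ k → 𝟙 (D (r + k)))
          ≡⟨ cong (∑< r (𝟙 ∘ x) +_) (∑<-split g r _) ⟩
        ∑< r (𝟙 ∘ x) + (∑< g (λ k → 𝟙 (D (r + k))) + ∑< r (𝟙 ∘ y))
          ≡⟨ cong (λ z → ∑< r (𝟙 ∘ x) + (z + ∑< r (𝟙 ∘ y))) mid ⟩
        ∑< r (𝟙 ∘ x) + ∑< r (𝟙 ∘ y)
          ≡⟨ ∑<-+ r (𝟙 ∘ x) (𝟙 ∘ y) ⟨
        ∑< r (λ k → 𝟙 (x k) + 𝟙 (y k)) ∎
        where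
        open ≡-Reasoning
        mid : ∑< g (λ k → 𝟙 (D (r + k))) ≡ 0
        mid with middle
        ... | inj₁ e  = e
        ... | inj₂ e with () ← trans (sym D0) e

  ∑B≤r : ∑< n (𝟙 ∘ B) ≤ r
  ∑B≤r with ∑<-zero⊎witness n B
  ... | inj₁ e = ≤-trans (≤-reflexive e) z≤n
  ... | inj₂ (i , _ , Bi) with p , ¬Bp , Bp ← edge Bi =
    ≤-trans (≤-reflexive (sum≡ (trans (cong B (+-identityʳ (suc p))) Bp))) (pairing-≤ r x y ¬both)
    where open Edge ¬Bp

  ∑B<r⊎Window : ∑< n (𝟙 ∘ B) < r ⊎ ∃ λ p → p < n × Window p
  ∑B<r⊎Window with ∑<-zero⊎witness n B
  ... | inj₁ e = inj₁ (subst (_< r) (sym e) 1≤r)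
  ... | inj₂ (i , _ , Bi) with p , ¬Bp , Bp ← edge Bi
    with pairing-full r _ _ (Edge.¬both ¬Bp) (Edge.¬next ¬Bp) (Edge.last ¬Bp)
  ...   | inj₁ lt = inj₁ (subst (_< r) (sym (Edge.sum≡ ¬Bp (trans (cong B (+-identityʳ (suc p))) Bp))) lt)
  -- The rise may lie beyond the first period; its start is reduced because windows are later
  -- counted over starts below n.
  ...   | inj₂ all = inj₂ (suc p % n , m%n<n (suc p) n , λ i i<r → trans (reduce i) (all i i<r))
    where
    reduce : ∀ i → B (suc p % n + i) ≡ B (suc p + i)
    reduce i = sym (trans (cong B (trans (cong (_+ i) (m≡m%n+[m/n]*n (suc p) n)) eq)) (periodic* (suc p / n) _))
      where
      open +-*-Solver
      eq : suc p % n + (suc p / n) * n + i ≡ suc p % n + i + (suc p / n) * n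
      eq = solve 3 (λ a b c → a :+ b :+ c := a :+ c :+ b) refl (suc p % n) ((suc p / n) * n) i

-- Arcs of a circular word, rotations and adjacent transpositions

does-true : ∀ {A : Set} (a? : Dec A) → does a? ≡ true → A
does-true (yes a) _ = a

all< : ℕ → (ℕ → Bool) → Bool
all< zero    f = true
all< (suc r) f = f 0 ∧ all< r (f ∘ suc)

all<-cong : ∀ r {f g} → (∀ i → f i ≡ g i) → all< r f ≡ all< r g
all<-cong zero    eq = refl
all<-cong (suc r) eq = cong₂ _∧_ (eq 0) (all<-cong r (eq ∘ suc))

all<-elim : ∀ r {f} → all< r f ≡ true → ∀ i → i < r → f i ≡ true
all<-elim (suc r) {f} e i       lt       with f 0 in f0
all<-elim (suc r) {f} e zero    lt       | true = f0
all<-elim (suc r) {f} e (suc i) (s≤s lt) | true = all<-elim r e i lt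

all<-intro : ∀ r {f} → (∀ i → i < r → f i ≡ true) → all< r f ≡ true
all<-intro zero    _   = refl
all<-intro (suc r) {f} all rewrite all 0 (s≤s z≤n) = all<-intro r λ i lt → all (suc i) (s≤s lt)

infixl 7 _∘ᵛ_

_∘ᵛ_ : ∀ {A : Set} {k l} → Vec A k → (Fin l → Fin k) → Vec A l
w ∘ᵛ σ = tabulate (lookup w ∘ σ)

lookup-∘ᵛ : ∀ {A : Set} {k l} (w : Vec A k) (σ : Fin l → Fin k) i → lookup (w ∘ᵛ σ) i ≡ lookup w (σ i)
lookup-∘ᵛ w σ = lookup∘tabulate (lookup w ∘ σ)

-- If there is no position `suc j`, this is the identity, so j may be any natural number.
τ : ∀ {k} → ℕ → Fin k → Fin k
τ (suc j) zero                  = zero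
τ (suc j) (suc i)               = suc (τ j i)
τ {suc zero}    zero zero       = zero
τ {suc (suc k)} zero zero       = suc zero
τ zero (suc zero)               = zero
τ zero (suc (suc i))            = suc (suc i)

τ-involutive : ∀ {k} j (i : Fin k) → τ j (τ j i) ≡ i
τ-involutive (suc j) zero                  = refl
τ-involutive (suc j) (suc i)               = cong suc (τ-involutive j i)
τ-involutive {suc zero}    zero zero       = refl
τ-involutive {suc (suc k)} zero zero       = refl
τ-involutive zero (suc zero)               = refl
τ-involutive zero (suc (suc i))            = refl

τ-cases : ∀ {k} j (i : Fin k) → τ j i ≡ i ⊎
          (toℕ i ≡ j × toℕ (τ j i) ≡ suc j) ⊎ (toℕ i ≡ suc j × toℕ (τ j i) ≡ j)
τ-cases (suc j) zero = inj₁ refl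
τ-cases (suc j) (suc i) with τ-cases j i
... | inj₁ e               = inj₁ (cong suc e)
... | inj₂ (inj₁ (e , e′)) = inj₂ (inj₁ (cong suc e , cong suc e′))
... | inj₂ (inj₂ (e , e′)) = inj₂ (inj₂ (cong suc e , cong suc e′))
τ-cases {suc zero}    zero zero = inj₁ refl
τ-cases {suc (suc k)} zero zero = inj₂ (inj₁ (refl , refl))
τ-cases zero (suc zero)         = inj₂ (inj₂ (refl , refl))
τ-cases zero (suc (suc i))      = inj₁ refl

module Arcs (m r : ℕ) where

  private
    n : ℕ
    n = suc m

  %-absorbˡ : ∀ a b → (a % n + b) % n ≡ (a + b) % n
  %-absorbˡ a b = trans (%-distribˡ-+ (a % n) b n)
    (trans (cong (λ z → (z + b % n) % n) (m%n%n≡m%n a n)) (sym (%-distribˡ-+ a b n)))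

  Arc : ℕ → Fin n → Set
  Arc i k = (toℕ k + i) % n < r

  Arc? : ∀ i k → Dec (Arc i k)
  Arc? i k = (toℕ k + i) % n <? r

  Covers? : (w : Vec (Fin n) n) (i : ℕ) (v : Fin n) → Dec (∃ λ k → Arc i k × lookup w k ≡ v)
  Covers? w i v = any? λ k → Arc? i k ×-dec (lookup w k ≟ᶠ v)

  -- Sealed, so that the search behind `image` is never unfolded; the two membership rules are its
  -- whole interface.
  abstract
    image : Vec (Fin n) n → ℕ → Subset n
    image w i = tabulate λ v → does (Covers? w i v)

    ∈-image⁻ : ∀ w i {v} → v ∈ image w i → ∃ λ k → Arc i k × lookup w k ≡ v
    ∈-image⁻ w i {v} v∈ = does-true (Covers? w i v)
      (trans (sym (lookup∘tabulate (λ v → does (Covers? w i v)) v)) ([]=⇒lookup v∈))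

    ∈-image⁺ : ∀ w i {k} → Arc i k → lookup w k ∈ image w i
    ∈-image⁺ w i {k} a = lookup⇒[]= (lookup w k) (image w i)
      (trans (lookup∘tabulate (λ v → does (Covers? w i v)) (lookup w k))
        (dec-true (Covers? w i (lookup w k)) (k , a , refl)))

  image-reindex : ∀ w {i i′} (σ σ⁻¹ : Fin n → Fin n) → (∀ k → σ (σ⁻¹ k) ≡ k) →
                  (∀ k → Arc i k → Arc i′ (σ k)) → (∀ k → Arc i′ k → Arc i (σ⁻¹ k)) →
                  image (w ∘ᵛ σ) i ≡ image w i′
  image-reindex w {i} {i′} σ σ⁻¹ inv to from = ⊆-antisym ⊆₁ ⊆₂
    where
    ⊆₁ : image (w ∘ᵛ σ) i ⊆ image w i′
    ⊆₁ v∈ with k , a , refl ← ∈-image⁻ (w ∘ᵛ σ) i v∈ =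
      subst (_∈ image w i′) (sym (lookup-∘ᵛ w σ k)) (∈-image⁺ w i′ (to k a))
    ⊆₂ : image w i′ ⊆ image (w ∘ᵛ σ) i
    ⊆₂ v∈ with k , a , refl ← ∈-image⁻ w i′ v∈ =
      subst (_∈ image (w ∘ᵛ σ) i) (trans (lookup-∘ᵛ w σ (σ⁻¹ k)) (cong (lookup w) (inv k)))
        (∈-image⁺ (w ∘ᵛ σ) i {σ⁻¹ k} (from k a))

  image-periodic : ∀ w i → image w (i + n) ≡ image w i
  image-periodic w i = ⊆-antisym
    (λ v∈ → let k , a , e = ∈-image⁻ w (i + n) v∈ in
      subst (_∈ image w i) e (∈-image⁺ w i (subst (_< r) (eq k) a)))
    (λ v∈ → let k , a , e = ∈-image⁻ w i v∈ in
      subst (_∈ image w (i + n)) e (∈-image⁺ w (i + n) (subst (_< r) (sym (eq k)) a)))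
    where
    eq : ∀ k → (toℕ k + (i + n)) % n ≡ (toℕ k + i) % n
    eq k = trans (cong (_% n) (sym (+-assoc (toℕ k) i n))) ([m+n]%n≡m%n (toℕ k + i) n)

  ρ ρ⁻¹ : Fin n → Fin n
  ρ   k = fromℕ< (m%n<n (suc (toℕ k)) n)
  ρ⁻¹ k = fromℕ< (m%n<n (toℕ k + m) n)

  toℕ-ρ : ∀ k → toℕ (ρ k) ≡ suc (toℕ k) % n
  toℕ-ρ k = toℕ-fromℕ< _

  toℕ-ρ⁻¹ : ∀ k → toℕ (ρ⁻¹ k) ≡ (toℕ k + m) % n
  toℕ-ρ⁻¹ k = toℕ-fromℕ< _

  private
    full-turn : ∀ k → (toℕ k + n) % n ≡ toℕ k
    full-turn k = trans ([m+n]%n≡m%n (toℕ k) n) (m<n⇒m%n≡m (toℕ<n k))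

  ρ∘ρ⁻¹ : ∀ k → ρ (ρ⁻¹ k) ≡ k
  ρ∘ρ⁻¹ k = toℕ-injective (begin
    toℕ (ρ (ρ⁻¹ k))          ≡⟨ toℕ-ρ (ρ⁻¹ k) ⟩
    suc (toℕ (ρ⁻¹ k)) % n    ≡⟨ cong (λ z → suc z % n) (toℕ-ρ⁻¹ k) ⟩
    suc ((toℕ k + m) % n) % n ≡⟨ cong (_% n) (+-comm 1 _) ⟩
    ((toℕ k + m) % n + 1) % n ≡⟨ %-absorbˡ (toℕ k + m) 1 ⟩
    (toℕ k + m + 1) % n      ≡⟨ cong (_% n) (trans (+-assoc (toℕ k) m 1) (cong (toℕ k +_) (+-comm m 1))) ⟩
    (toℕ k + n) % n          ≡⟨ full-turn k ⟩
    toℕ k                    ∎)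
    where open ≡-Reasoning

  ρ⁻¹∘ρ : ∀ k → ρ⁻¹ (ρ k) ≡ k
  ρ⁻¹∘ρ k = toℕ-injective (begin
    toℕ (ρ⁻¹ (ρ k))            ≡⟨ toℕ-ρ⁻¹ (ρ k) ⟩
    (toℕ (ρ k) + m) % n        ≡⟨ cong (λ z → (z + m) % n) (toℕ-ρ k) ⟩
    (suc (toℕ k) % n + m) % n  ≡⟨ %-absorbˡ (suc (toℕ k)) m ⟩
    (suc (toℕ k) + m) % n      ≡⟨ cong (_% n) (sym (+-suc (toℕ k) m)) ⟩
    (toℕ k + n) % n            ≡⟨ full-turn k ⟩
    toℕ k                      ∎)
    where open ≡-Reasoning

  image-rotate : ∀ w i → image (w ∘ᵛ ρ) (suc i) ≡ image w i
  image-rotate w i = image-reindex w ρ ρ⁻¹ ρ∘ρ⁻¹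
    (λ k → subst (_< r) (sym (eq k)))
    (λ k a → subst (_< r) (trans (cong (λ z → (toℕ z + i) % n) (sym (ρ∘ρ⁻¹ k))) (eq (ρ⁻¹ k))) a)
    where
    eq : ∀ k → (toℕ (ρ k) + i) % n ≡ (toℕ k + suc i) % n
    eq k = trans (cong (λ z → (z + i) % n) (toℕ-ρ k))
      (trans (%-absorbˡ (suc (toℕ k)) i) (cong (_% n) (sym (+-suc (toℕ k) i))))

  -- No end of arc i lies between positions j and j + 1.
  NotCut : ℕ → ℕ → Set
  NotCut j i = suc j < n → suc ((j + i) % n) ≢ r × suc ((j + i) % n) ≢ n

  suc-% : ∀ a → suc (a % n) ≢ n → suc a % n ≡ suc (a % n)
  suc-% a ≢n = trans (cong (_% n) (+-comm 1 a)) (trans (sym (%-absorbˡ a 1))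
    (trans (cong (_% n) (+-comm (a % n) 1)) (m<n⇒m%n≡m (≤∧≢⇒< (m%n<n a n) ≢n))))

  Arc-τ : ∀ {j i} → NotCut j i → ∀ k → Arc i k → Arc i (τ j k)
  Arc-τ {j} {i} nc k a with τ-cases j k
  ... | inj₁ e = subst (Arc i) (sym e) a
  ... | inj₂ (inj₁ (e , e′)) = subst (λ z → (z + i) % n < r) (sym e′)
        (subst (_< r) (sym (suc-% (j + i) ≢n)) (≤∧≢⇒< (subst (λ z → (z + i) % n < r) e a) ≢r))
    where
    j<m = subst (_< n) e′ (toℕ<n (τ j k))
    ≢r = proj₁ (nc j<m)
    ≢n = proj₂ (nc j<m)
  ... | inj₂ (inj₂ (e , e′)) = subst (λ z → (z + i) % n < r) (sym e′)
        (<⇒≤ (subst (_< r) (suc-% (j + i) ≢n) (subst (λ z → (z + i) % n < r) e a)))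
    where
    ≢n = proj₂ (nc (subst (_< n) e (toℕ<n k)))

  image-τ : ∀ w {j i} → NotCut j i → image (w ∘ᵛ τ j) i ≡ image w i
  image-τ w {j} nc = image-reindex w (τ j) (τ j) (τ-involutive j) (Arc-τ nc) (Arc-τ nc)

-- Arcs that are edges, windows and exceptional words

infix 4 _≟ˢ_ _∈ᴸ?_

_≟ˢ_ : (S S′ : Subset N) → Dec (S ≡ S′)
_≟ˢ_ = ≡-dec Bool._≟_

_∈ᴸ?_ : (S : Subset N) (Ss : List (Subset N)) → Dec (S ∈ᴸ Ss)
_∈ᴸ?_ = DecMembership._∈?_ _≟ˢ_

module Circle (m r : ℕ) (1≤r : 1 ≤ r) (2r<n : 2 * r < suc m)
              (edges : List (Subset (suc m)))
              (intersecting : ∀ {e f} → e ∈ᴸ edges → f ∈ᴸ edges → Nonempty (e ∩ f)) where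

  private
    n : ℕ
    n = suc m

  open Arcs m r public
  B : Vec (Fin n) n → ℕ → Bool
  B w i = does (image w i ∈ᴸ? edges)

  B⇒∈ : ∀ w i → B w i ≡ true → image w i ∈ᴸ edges
  B⇒∈ w i = does-true (image w i ∈ᴸ? edges)

  B-cong : ∀ w w′ i i′ → image w i ≡ image w′ i′ → B w i ≡ B w′ i′
  B-cong w w′ i i′ = cong (λ S → does (S ∈ᴸ? edges))

  B-periodic : ∀ w i → B w (i + n) ≡ B w i
  B-periodic w i = B-cong w w _ _ (image-periodic w i)

  B-rotate : ∀ w i → B (w ∘ᵛ ρ) (suc i) ≡ B w i
  B-rotate w i = B-cong (w ∘ᵛ ρ) w _ _ (image-rotate w i)

  -- By injectivity a common vertex has the same position in both arcs. Its offset in arc i is below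
  -- r, so its offset in arc i + d is larger by d without wrapping around, hence at least r.
  far : ∀ {w} → Injective w → ∀ i d → r ≤ d → d + r ≤ n → B w i ≡ true → B w (i + d) ≡ true → ⊥
  far {w} inj i d r≤d d+r≤n Bi Bd with intersecting (B⇒∈ w i Bi) (B⇒∈ w (i + d) Bd)
  ... | v , v∈ with v∈₁ , v∈₂ ← x∈p∩q⁻ _ _ v∈
    with k , a , e ← ∈-image⁻ w i v∈₁ with k′ , a′ , e′ ← ∈-image⁻ w (i + d) v∈₂
    with refl ← inj {k} {k′} (trans e (sym e′)) =
    <⇒≱ (subst (_< r) eq a′) (≤-trans r≤d (m≤n+m d x))
    where
    x = (toℕ k + i) % n
    eq : (toℕ k + (i + d)) % n ≡ x + d
    eq = trans (cong (_% n) (sym (+-assoc (toℕ k) i d)))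
      (trans (sym (%-absorbˡ (toℕ k + i) d))
        (m<n⇒m%n≡m (<-≤-trans (+-monoˡ-< d a) (≤-trans (≤-reflexive (+-comm r d)) d+r≤n))))

  -- The arcs p, ..., p + r - 1 are those through position -p: w points out the vertex there, and
  -- for p = 0 the vertex in front.
  h : ℕ → Vec (Fin n) n → Bool
  h p w = all< r λ i → B w (p + i)

  h-rotate : ∀ w p → h (suc p) (w ∘ᵛ ρ) ≡ h p w
  h-rotate w p = all<-cong r λ i → B-rotate w (p + i)

  private
    r<2r : r < r + r
    r<2r = m<m+n r 1≤r

    r+r<n : r + r < n
    r+r<n = subst (_< n) (cong (r +_) (+-identityʳ r)) 2r<n

  -- If the windows of w and w ∘ τ were different, two disjoint arcs, one from each window, could be chosen
  -- such that not both are cut by the transposition; that one is an edge for both words.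
  window-stable : ∀ {w} → Injective w → ∀ j p → 1 ≤ p → p < n → h 0 w ≡ true →
                  h p (w ∘ᵛ τ (suc j)) ≡ true → ⊥
  window-stable {w} inj j p 1≤p p<n h₀ hₚ = cases
    where
    w′ = w ∘ᵛ τ (suc j)
    inj′ : Injective w′
    inj′ {k} {l} e = trans (sym (τ-involutive (suc j) k)) (trans (cong (τ (suc j))
      (inj (trans (sym (lookup-∘ᵛ w (τ (suc j)) k)) (trans e (lookup-∘ᵛ w (τ (suc j)) l))))) (τ-involutive (suc j) l))
    stable : ∀ {i} → NotCut (suc j) i → B w′ i ≡ B w i
    stable nc = B-cong w′ w _ _ (image-τ w nc)
    contra : ∀ i d → r ≤ d → d + r ≤ n → B w i ≡ true → B w′ (i + d) ≡ true →
             NotCut (suc j) i ⊎ NotCut (suc j) (i + d) → ⊥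
    contra i d r≤d d+r≤n b b′ (inj₁ nc) = far {w′} inj′ i d r≤d d+r≤n (trans (stable nc) b) b′
    contra i d r≤d d+r≤n b b′ (inj₂ nc) = far {w} inj i d r≤d d+r≤n b (trans (sym (stable nc)) b′)
    in₀ : ∀ i → i < r → B w i ≡ true
    in₀ = all<-elim r h₀
    inₚ : ∀ i → p ≤ i → i < p + r → B w′ i ≡ true
    inₚ i p≤i i<p+r = subst (λ z → B w′ z ≡ true) (m+[n∸m]≡n p≤i)
      (all<-elim r hₚ (i ∸ p) (+-cancelˡ-< p _ _ (subst (_< p + r) (sym (m+[n∸m]≡n p≤i)) i<p+r)))

    -- As position 0 is not moved, arc 0 can be cut only at its far end, when `suc (suc j)` is r. In
    -- that case d + r < n keeps both ends of arc d away from the swapped pair.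
    near : ∀ d → r ≤ d → d + r < n → NotCut (suc j) 0 ⊎ NotCut (suc j) d
    near d r≤d d+r<n with suc (suc j) ≟ r
    ... | no ≢r = inj₁ λ lt →
          subst (λ z → suc z ≢ r × suc z ≢ n) (sym (trans (cong (_% n) (+-identityʳ (suc j))) (m<n⇒m%n≡m (<⇒≤ lt))))
            (≢r , <⇒≢ lt)
    ... | yes refl = inj₂ λ _ →
          subst (λ z → suc z ≢ r × suc z ≢ n) (sym (m<n⇒m%n≡m (<⇒≤ r+d<n)))
            ((λ e → <⇒≢ (m<m+n r (≤-trans 1≤r r≤d)) (sym e)) , <⇒≢ r+d<n)
      where
      r+d<n : r + d < n
      r+d<n = subst (_< n) (+-comm d r) d+r<n

    -- These arcs meet between positions 0 and 1, which no `τ (suc j)` exchanges. Their other ends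
    -- come after positions n - r and r, which differ because 2r < n.
    at-end : NotCut (suc j) (r ∸ 1) ⊎ NotCut (suc j) m
    at-end with suc j ≟ r
    ... | no ≢r = inj₂ λ lt →
          subst (λ z → suc z ≢ r × suc z ≢ n)
            (sym (trans (cong (_% n) (sym (+-suc j m))) (trans ([m+n]%n≡m%n j n) (m<n⇒m%n≡m (<⇒≤ (<⇒≤ lt))))))
            (≢r , <⇒≢ (<⇒≤ lt))
    ... | yes refl = inj₁ λ _ →
          subst (λ z → suc z ≢ r × suc z ≢ n) (sym (m<n⇒m%n≡m (<⇒≤ r+j<n)))
            ((λ e → <⇒≢ r<2r (sym (trans (+-suc r j) e))) , <⇒≢ r+j<n)
      where
      r+j<n : suc (r + j) < n
      r+j<n = subst (_< n) (+-suc r j) r+r<n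

    cases : ⊥
    -- Arc 0 is paired with arc r or arc p of the other window as long as the distance d satisfies d
    -- + r < n. Once p + r reaches n, arcs r - 1 and n - 1 are taken instead.
    cases with p ≤? r
    ... | yes p≤r = contra 0 r ≤-refl (<⇒≤ r+r<n) (in₀ 0 1≤r) (inₚ r p≤r (m<n+m r 1≤p)) (near r ≤-refl r+r<n)
    ... | no  p≰r with p + r <? n
    ...   | yes p+r<n = contra 0 p (<⇒≤ (≰⇒> p≰r)) (<⇒≤ p+r<n) (in₀ 0 1≤r)
                          (inₚ p ≤-refl (m<m+n p 1≤r)) (near p (<⇒≤ (≰⇒> p≰r)) p+r<n)
    ...   | no  p+r≮n = contra (r ∸ 1) (n ∸ r) (m+n≤o⇒m≤o∸n r (<⇒≤ r+r<n))
                          (≤-reflexive (m∸n+n≡m r≤n)) (in₀ (r ∸ 1) (≤-reflexive (m+[n∸m]≡n 1≤r)))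
                          (subst (λ z → B w′ z ≡ true) (sym eq) (inₚ m (s≤s⁻¹ p<n) (≮⇒≥ p+r≮n)))
                          (subst (λ z → NotCut (suc j) (r ∸ 1) ⊎ NotCut (suc j) z) (sym eq) at-end)
      where
      r≤n : r ≤ n
      r≤n = ≤-trans (m≤m+n r r) (<⇒≤ r+r<n)
      eq : r ∸ 1 + (n ∸ r) ≡ m
      eq = suc-injective (trans (cong (_+ (n ∸ r)) (m+[n∸m]≡n 1≤r)) (m+[n∸m]≡n r≤n))

  -- The indicator of the exceptional words. Truncated subtraction gives 0 as soon as there is a
  -- window, so that the number of windows never has to be bounded above.
  bad : Vec (Fin n) n → ℕ
  bad w = 1 ∸ ∑< n (λ p → 𝟙 (h p w))

  bad-∑h : ∀ w → 1 ≤ bad w + ∑< n (λ p → 𝟙 (h p w))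
  bad-∑h w = ≤-trans (m≤n+m∸n 1 (∑< n (λ p → 𝟙 (h p w)))) (≤-reflexive (+-comm _ (bad w)))

  -- The case of equality in the cycle lemma as an inequality that can be summed: an exceptional
  -- word has at least one edge fewer than r.
  bad-∑B : ∀ {w} → Injective w → bad w + ∑< n (𝟙 ∘ B w) ≤ r
  bad-∑B {w} inj with Cyclic.∑B<r⊎Window m r 1≤r 2r<n (B w) (B-periodic w) (far {w} inj)
  ... | inj₁ lt = ≤-trans (+-monoˡ-≤ _ (m∸n≤m 1 (∑< n (λ p → 𝟙 (h p w))))) lt
  ... | inj₂ (p , p<n , win) =
    subst (λ z → z + ∑< n (𝟙 ∘ B w) ≤ r) (sym (m≤n⇒m∸n≡0 1≤∑h))
      (Cyclic.∑B≤r m r 1≤r 2r<n (B w) (B-periodic w) (far {w} inj))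
    where
    1≤∑h : 1 ≤ ∑< n (λ p → 𝟙 (h p w))
    1≤∑h = ≤-trans (≤-reflexive (cong 𝟙 (sym (all<-intro r win)))) (∑<-member n (λ p → 𝟙 (h p w)) p<n)

  bad≡1 : ∀ w → (∀ p → p < n → h p w ≡ true → ⊥) → bad w ≡ 1
  bad≡1 w ¬h = cong (1 ∸_) (trans (∑<-cong n λ {p} p<n → cong 𝟙 (Bool.¬-not (¬h p p<n)))
    (trans (∑<-const n 0) (*-zeroʳ n)))

  -- Once the front is no longer pointed out, a window at p > 0 is excluded by `window-stable` and
  -- one at 0 by assumption, so none remains.
  transition : ∀ {w} → Injective w → ∀ j →
               𝟙 (h 0 w) * 𝟙 (not (h 0 (w ∘ᵛ τ (suc j)))) ≤ bad (w ∘ᵛ τ (suc j))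
  transition {w} inj j = bool-case (h 0 w) (h 0 w′) λ h₀ ¬h₀′ →
    ≤-reflexive (sym (bad≡1 w′ λ
      { zero    _     h₀′ → Bool.not-¬ ¬h₀′ (trans h₀′ refl)
      ; (suc p) p<n   hₚ  → window-stable {w} inj j (suc p) (s≤s z≤n) p<n h₀ hₚ }))
    where
    w′ = w ∘ᵛ τ (suc j)
    bool-case : ∀ a b {c} → (a ≡ true → b ≡ false → 1 ≤ c) → 𝟙 a * 𝟙 (not b) ≤ c
    bool-case false _     _ = z≤n
    bool-case true  true  _ = z≤n
    bool-case true  false f = f refl refl

-- Permutations and those with a prescribed beginning

permutations : ∀ n → List (Vec (Fin n) n)
permutations n = words n λ _ → ⊤

∈-permutations⁻ : ∀ {n} {w : Vec (Fin n) n} → w ∈ᴸ permutations n → Injective w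
∈-permutations⁻ {n} w∈ = proj₂ (∈-words⁻ n _ w∈)

∈-permutations⁺ : ∀ {n} {w : Vec (Fin n) n} → Injective w → w ∈ᴸ permutations n
∈-permutations⁺ {n} inj = ∈-words⁺ n _ (λ _ → ∈⊤) inj

lookup-ext : ∀ {A : Set} {n} {v w : Vec A n} → (∀ i → lookup v i ≡ lookup w i) → v ≡ w
lookup-ext {v = v} {w} eq = trans (sym (tabulate∘lookup v)) (trans (tabulate-cong eq) (tabulate∘lookup w))

∑-∘ᵛʳ : ∀ {n} (σ σ⁻¹ : Fin n → Fin n) → (∀ k → σ (σ⁻¹ k) ≡ k) → (∀ k → σ⁻¹ (σ k) ≡ k) → (φ : Vec (Fin n) n → ℕ) →
        ∑ (permutations n) (λ w → φ (w ∘ᵛ σ)) ≡ ∑ (permutations n) φ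
∑-∘ᵛʳ {n} σ σ⁻¹ inv inv′ = ∑-injective {f = _∘ᵛ σ} (unique-words n _)
  (λ {v} {w} eq → lookup-ext λ i → begin
    lookup v i               ≡⟨ cong (lookup v) (inv i) ⟨
    lookup v (σ (σ⁻¹ i))     ≡⟨ lookup-∘ᵛ v σ (σ⁻¹ i) ⟨
    lookup (v ∘ᵛ σ) (σ⁻¹ i)  ≡⟨ cong (λ z → lookup z (σ⁻¹ i)) eq ⟩
    lookup (w ∘ᵛ σ) (σ⁻¹ i)  ≡⟨ lookup-∘ᵛ w σ (σ⁻¹ i) ⟩
    lookup w (σ (σ⁻¹ i))     ≡⟨ cong (lookup w) (inv i) ⟩
    lookup w i               ∎)
  (λ {w} w∈ → ∈-permutations⁺ λ {i} {j} eq → trans (sym (inv′ i)) (trans (cong σ⁻¹ (∈-permutations⁻ w∈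
    (trans (sym (lookup-∘ᵛ w σ i)) (trans eq (lookup-∘ᵛ w σ j))))) (inv′ j)))
  where open ≡-Reasoning

∑-∘ᵛˡ : ∀ {n} {w : Vec (Fin n) n} → Injective w → (φ : Vec (Fin n) n → ℕ) →
        ∑ (permutations n) (λ σ → φ (w ∘ᵛ lookup σ)) ≡ ∑ (permutations n) φ
∑-∘ᵛˡ {n} {w} inj = ∑-injective {f = λ σ → w ∘ᵛ lookup σ} (unique-words n _)
  (λ {σ} {σ′} eq → lookup-ext λ i → inj (trans (sym (lookup-∘ᵛ w (lookup σ) i))
    (trans (cong (λ z → lookup z i) eq) (lookup-∘ᵛ w (lookup σ′) i))))
  (λ {σ} σ∈ → ∈-permutations⁺ λ {i} {j} eq → ∈-permutations⁻ σ∈ (inj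
    (trans (sym (lookup-∘ᵛ w (lookup σ) i)) (trans eq (lookup-∘ᵛ w (lookup σ) j)))))

count-words : ∀ {n} (T : ℕ → Subset n) → (∀ i {x} → x ∈ T i → x ∈ T (suc i)) →
              {P : Vec (Fin n) n → Set} (P? : Decidable P) →
              (∀ {w} → Injective w → P w → w ∈∏ T) → (∀ {w} → Injective w → w ∈∏ T → P w) →
              ∑ (permutations n) (λ w → 𝟙 (does (P? w))) ≡ falling n (∣_∣ ∘ T)
count-words {n} T mono P? to from = trans (∑-filter P? (permutations n))
  (trans (unique-length (filter⁺ P? (unique-words n _)) (unique-words n T)
    (λ w∈ → let w∈ , Pw = ∈-filter⁻ P? {xs = permutations n} w∈ ; inj = ∈-permutations⁻ w∈ in
      ∈-words⁺ n T (to inj Pw) inj)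
    (λ w∈ → let w∈T , inj = ∈-words⁻ n T w∈ in
      ∈-filter⁺ P? (∈-permutations⁺ inj) (from inj w∈T)))
   (length-words n T mono))

if-cong : ∀ {A B : Set} (f : A → B) b {x y : A} → f (if b then x else y) ≡ (if b then f x else f y)
if-cong f true  = refl
if-cong f false = refl

starts-at? : ∀ {m} (v : Fin (suc m)) (w : Vec (Fin (suc m)) (suc m)) → Dec (lookup w zero ≡ v)
starts-at? v w = lookup w zero ≟ᶠ v

count-starting : ∀ m (v : Fin (suc m)) → ∑ (permutations (suc m)) (λ w → 𝟙 (does (starts-at? v w))) ≡ m !
count-starting m v = trans
  (count-words T mono (starts-at? v) (λ { _ refl zero → x∈⁅x⁆ v ; _ _ (suc i) → ∈⊤ })
    (λ _ w∈ → x∈⁅y⁆⇒x≡y v (w∈ zero)))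
  (trans (cong₂ _*_ (∣⁅x⁆∣≡1 v) (trans (falling-cong m λ _ → cong (_∸ 1) (∣⊤∣≡n (suc m))) (falling-const m)))
    (*-identityˡ (m !)))
  where
  T : ℕ → Subset (suc m)
  T zero    = ⁅ v ⁆
  T (suc i) = ⊤
  mono : ∀ i {x} → x ∈ T i → x ∈ T (suc i)
  mono _ _ = ∈⊤

module Counting (m r′ : ℕ) (r<n : suc r′ < suc m) where

  private
    n r : ℕ
    n = suc m
    r = suc r′

  open Arcs m r

  r≤n : r ≤ n
  r≤n = <⇒≤ r<n

  Arc₀⁻ : ∀ {k} → Arc 0 k → toℕ k < r
  Arc₀⁻ {k} = subst (_< r) (trans (cong (_% n) (+-identityʳ (toℕ k))) (m<n⇒m%n≡m (toℕ<n k)))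

  Arc₀⁺ : ∀ {k} → toℕ k < r → Arc 0 k
  Arc₀⁺ {k} = subst (_< r) (sym (trans (cong (_% n) (+-identityʳ (toℕ k))) (m<n⇒m%n≡m (toℕ<n k))))

  image⇒prefix : ∀ {S} w → image w 0 ≡ S → ∀ k → toℕ k < r → lookup w k ∈ S
  image⇒prefix w refl k k<r = ∈-image⁺ w 0 (Arc₀⁺ k<r)

  -- Pigeonhole: r distinct letters inside an r-set exhaust it.
  prefix⇒image : ∀ {S} → ∣ S ∣ ≡ r → ∀ {w} → Injective w → (∀ k → toℕ k < r → lookup w k ∈ S) → image w 0 ≡ S
  prefix⇒image {S} ∣S∣ {w} inj pre = ⊆-antisym ⊆₁ ⊆₂
    where
    ⊆₁ : image w 0 ⊆ S
    ⊆₁ v∈ with k , a , refl ← ∈-image⁻ w 0 v∈ = pre k (Arc₀⁻ a)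
    pos : Fin r → Fin n
    pos k = inject≤ k r≤n
    pos<r : ∀ k → toℕ (pos k) < r
    pos<r k = subst (_< r) (sym (toℕ-inject≤ k r≤n)) (toℕ<n k)
    f : Fin r → Fin n
    f = lookup w ∘ pos
    values = List.tabulate f
    values⊆ : ∀ {v} → v ∈ᴸ values → v ∈ᴸ elements S
    values⊆ v∈ with k , refl ← ∈-tabulate⁻ {f = f} v∈ = ∈-elements⁺ (pre (pos k) (pos<r k))
    ⊆₂ : S ⊆ image w 0
    ⊆₂ v∈ with ∈-resp-↭ (↭-sym (unique-⊆⇒↭ (tabulate⁺ (λ eq → inject≤-injective r≤n r≤n _ _ (inj eq))) values⊆
        (≤-reflexive (trans (length-elements S) (trans ∣S∣ (sym (length-tabulate f))))))) (∈-elements⁺ v∈)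
    ... | v∈′ with k , refl ← ∈-tabulate⁻ {f = f} v∈′ = ∈-image⁺ w 0 (Arc₀⁺ (pos<r k))

  <ᵇ-true : ∀ {i j} → i < j → (i <ᵇ j) ≡ true
  <ᵇ-true {zero}  {suc j} _        = refl
  <ᵇ-true {suc i} {suc j} (s≤s lt) = <ᵇ-true lt

  Block : Subset n → ℕ → ℕ → Subset n
  Block S l i = if i <ᵇ l then S else ⊤

  Block-mono : ∀ S l i {x} → x ∈ Block S l i → x ∈ Block S l (suc i)
  Block-mono S zero    i       x∈ = x∈
  Block-mono S (suc l) zero    x∈ = S⊆ l x∈
    where
    S⊆ : ∀ l {x} → x ∈ S → x ∈ Block S l 0
    S⊆ zero    _  = ∈⊤
    S⊆ (suc l) x∈ = x∈
  Block-mono S (suc l) (suc i) x∈ = Block-mono S l i x∈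

  ∈-Block : ∀ S l i {x} → (i < l → x ∈ S) → x ∈ Block S l i
  ∈-Block S zero    i       _ = ∈⊤
  ∈-Block S (suc l) zero    f = f (s≤s z≤n)
  ∈-Block S (suc l) (suc i) f = ∈-Block S l i (f ∘ s≤s)

  Block⊆ : ∀ S l i {x} → i < l → x ∈ Block S l i → x ∈ S
  Block⊆ S l i {x} lt = subst (λ b → x ∈ (if b then S else ⊤)) (<ᵇ-true lt)

  ∣Block∣ : ∀ {S} → ∣ S ∣ ≡ r → ∀ l i → ∣ Block S l i ∣ ≡ (if i <ᵇ l then r else n)
  ∣Block∣ {S} ∣S∣ l i = trans (if-cong ∣_∣ (i <ᵇ l))
    (cong₂ (if i <ᵇ l then_else_) ∣S∣ (∣⊤∣≡n n))

  falling-block : ∀ {l k} → l ≤ k → falling k (λ i → if i <ᵇ l then l else k) ≡ l ! * (k ∸ l) !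
  falling-block {l} {k} l≤k = subst (λ z → falling z (λ i → if i <ᵇ l then l else z) ≡ l ! * (k ∸ l) !)
    (m+[n∸m]≡n l≤k) (falling-step l (k ∸ l))

  count-image : ∀ {S} → ∣ S ∣ ≡ r →
                ∑ (permutations n) (λ w → 𝟙 (does (image w 0 ≟ˢ S))) ≡ r ! * (n ∸ r) !
  count-image {S} ∣S∣ = trans
    (count-words (Block S r) (Block-mono S r) (λ w → image w 0 ≟ˢ S)
      (λ {w} _ eq k → ∈-Block S r (toℕ k) (image⇒prefix w eq k))
      (λ inj w∈ → prefix⇒image ∣S∣ inj λ k k<r → Block⊆ S r (toℕ k) k<r (w∈ k)))
    (trans (falling-cong n (∣Block∣ {S} ∣S∣ r)) (falling-block r≤n))

  -- The number of words whose arc 0 is a given r-set with a given vertex of it in front; with the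
  -- front left free there are r times as many.
  M : ℕ
  M = r′ ! * (n ∸ r) !

  count-starting-image : ∀ {S v} → ∣ S ∣ ≡ r → v ∈ S →
    ∑ (permutations n) (λ w → 𝟙 (does (starts-at? v w ×-dec (image w 0 ≟ˢ S)))) ≡ M
  count-starting-image {S} {v} ∣S∣ v∈S = trans
    (count-words T mono (λ w → starts-at? v w ×-dec (image w 0 ≟ˢ S))
      (λ { {w} _ (refl , eq) zero    → x∈⁅x⁆ v
         ; {w} _ (refl , eq) (suc k) → ∈-Block S r′ (toℕ k) (λ k<r′ → image⇒prefix w eq (suc k) (s≤s k<r′)) })
      (λ {w} inj w∈ → x∈⁅y⁆⇒x≡y v (w∈ zero) , prefix⇒image ∣S∣ inj (prefix w w∈)))
    (trans (cong₂ _*_ (∣⁅x⁆∣≡1 v) (trans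
      (falling-cong m λ i → trans (cong (_∸ 1) (∣Block∣ {S} ∣S∣ r′ i)) (if-cong (_∸ 1) (i <ᵇ r′)))
      (falling-block (<⇒≤ (s≤s⁻¹ r<n))))) (*-identityˡ M))
    where
    T : ℕ → Subset n
    T zero    = ⁅ v ⁆
    T (suc i) = Block S r′ i
    mono : ∀ i {x} → x ∈ T i → x ∈ T (suc i)
    -- This is where `v ∈ S` makes the sets increase, as `length-words` demands.
    mono zero    x∈ with refl ← x∈⁅y⁆⇒x≡y v x∈ = ∈-Block S r′ 0 λ _ → v∈S
    mono (suc i) x∈ = Block-mono S r′ i x∈
    prefix : ∀ w → w ∈∏ T → ∀ k → toℕ k < r → lookup w k ∈ S
    prefix w w∈ zero    _          = subst (_∈ S) (sym (x∈⁅y⁆⇒x≡y v (w∈ zero))) v∈S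
    prefix w w∈ (suc k) (s≤s k<r′) = Block⊆ S r′ (toℕ k) k<r′ (w∈ (suc k))

  count-starting-image-∉ : ∀ {S v} → ¬ (v ∈ S) →
    ∑ (permutations n) (λ w → 𝟙 (does (starts-at? v w ×-dec (image w 0 ≟ˢ S)))) ≡ 0
  count-starting-image-∉ {S} {v} v∉S = trans
    (∑-cong (permutations n) λ w → cong 𝟙 (dec-false (starts-at? v w ×-dec (image w 0 ≟ˢ S))
      λ { (refl , eq) → v∉S (image⇒prefix w eq zero (s≤s z≤n)) }))
    (trans (∑-const (permutations n) 0) (*-zeroʳ (length (permutations n))))

-- Sorting by adjacent transpositions

act : List ℕ → Vec A k → Vec A k
act []      w = w
act (j ∷ l) w = act l (w ∘ᵛ τ j)

act-++ : ∀ l l′ (w : Vec A k) → act (l ++ l′) w ≡ act l′ (act l w)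
act-++ []      l′ w = refl
act-++ (j ∷ l) l′ w = act-++ l l′ (w ∘ᵛ τ j)

act-suc : ∀ l x (w : Vec A k) → act (List.map suc l) (x ∷ w) ≡ x ∷ act l w
act-suc []      x w = refl
act-suc (j ∷ l) x w = act-suc l x (w ∘ᵛ τ j)

act-↭ : ∀ l (w : Vec A k) → toList (act l w) ↭ toList w
act-↭ []      w = ↭-refl
act-↭ (j ∷ l) w = ↭-trans (act-↭ l (w ∘ᵛ τ j)) (τ-↭ j w)
  where
  τ-↭ : ∀ {k} j (w : Vec A k) → toList (w ∘ᵛ τ j) ↭ toList w
  τ-↭ j       []           = ↭-refl
  τ-↭ (suc j) (x ∷ w)      = prep x (τ-↭ j w)
  τ-↭ zero    (x ∷ [])     = ↭-refl
  τ-↭ zero    (x ∷ y ∷ w)  = swap y x (↭-reflexive (cong toList (tabulate∘lookup w)))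

-- Acting on positions commutes with renaming letters by w, so one decomposition of a permutation
-- serves all words at once.
act-∘ᵛ : ∀ l (w : Vec A N) (π : Vec (Fin N) k) → act l (w ∘ᵛ lookup π) ≡ w ∘ᵛ lookup (act l π)
act-∘ᵛ []      w π = refl
act-∘ᵛ (j ∷ l) w π = trans (cong (act l) (lookup-ext λ i → begin
  lookup (w ∘ᵛ lookup π ∘ᵛ τ j) i  ≡⟨ lookup-∘ᵛ (w ∘ᵛ lookup π) (τ j) i ⟩
  lookup (w ∘ᵛ lookup π) (τ j i)   ≡⟨ lookup-∘ᵛ w (lookup π) (τ j i) ⟩
  lookup w (lookup π (τ j i))      ≡⟨ cong (lookup w) (lookup-∘ᵛ π (τ j) i) ⟨
  lookup w (lookup (π ∘ᵛ τ j) i)   ≡⟨ lookup-∘ᵛ w (lookup (π ∘ᵛ τ j)) i ⟨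
  lookup (w ∘ᵛ lookup (π ∘ᵛ τ j)) i ∎)) (act-∘ᵛ l w (π ∘ᵛ τ j))
  where open ≡-Reasoning

bubble : ∀ {y} (xs : Vec A (suc k)) → y ∈ᴸ toList xs →
         ∃₂ λ l xs′ → length l ≤ k × act l xs ≡ y ∷ xs′
bubble         (x ∷ xs)      (here refl) = [] , xs , z≤n , refl
bubble {k = suc k} (x ∷ x′ ∷ xs) (there y∈) with bubble (x′ ∷ xs) y∈
... | l , xs′ , len , eq = List.map suc l ++ 0 ∷ [] , x ∷ xs′ , len′ , eq′
  where
  len′ : length (List.map suc l ++ 0 ∷ []) ≤ suc k
  len′ = ≤-trans (≤-reflexive (trans (length-++ (List.map suc l))
    (trans (cong (_+ 1) (length-map suc l)) (+-comm (length l) 1)))) (s≤s len)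
  eq′ : act (List.map suc l ++ 0 ∷ []) (x ∷ x′ ∷ xs) ≡ _
  eq′ = trans (act-++ (List.map suc l) (0 ∷ []) (x ∷ x′ ∷ xs)) (trans
    (cong (_∘ᵛ τ 0) (trans (act-suc l x (x′ ∷ xs)) (cong (x ∷_) eq)))
    (cong (λ z → _ ∷ x ∷ z) (tabulate∘lookup xs′)))

bubble-sort : (xs ys : Vec A k) → toList xs ↭ toList ys → ∃ λ l → length l ≤ k * k × act l xs ≡ ys
bubble-sort []       []       _ = [] , z≤n , refl
bubble-sort {k = suc k} (x ∷ xs) (y ∷ ys) p with bubble (x ∷ xs) (∈-resp-↭ (↭-sym p) (here refl))
... | l , xs′ , len , eq with bubble-sort xs′ ys (drop-∷ (↭-trans
        (↭-reflexive (cong toList (sym eq))) (↭-trans (act-↭ l (x ∷ xs)) p)))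
...   | l′ , len′ , eq′ = l ++ List.map suc l′ , length≤ ,
        trans (act-++ l (List.map suc l′) (x ∷ xs)) (trans (cong (act (List.map suc l′)) eq)
          (trans (act-suc l′ y xs′) (cong (y ∷_) eq′)))
  where
  length≤ : length (l ++ List.map suc l′) ≤ suc k * suc k
  length≤ = ≤-trans (≤-reflexive (trans (length-++ l) (cong (length l +_) (length-map suc l′))))
    (+-mono-≤ (m≤n⇒m≤1+n len) (≤-trans len′ (*-monoʳ-≤ k (n≤1+n k))))

injective⇒↭allFin : {w : Vec (Fin N) N} → Injective w → toList w ↭ List.allFin N
injective⇒↭allFin {N} {w} inj = ↭-trans (↭-reflexive (toList≡ w))
  (unique-⊆⇒↭ (tabulate⁺ inj) (λ {x} _ → ∈-allFin x)
    (≤-reflexive (trans (length-tabulate {n = N} id) (sym (length-tabulate (lookup w))))))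
  where
  toList≡ : ∀ {k} (w : Vec (Fin N) k) → toList w ≡ List.tabulate (lookup w)
  toList≡ []      = refl
  toList≡ (x ∷ w) = cong (x ∷_) (toList≡ w)

surjective : {w : Vec (Fin N) N} → Injective w → ∀ v → ∃ λ k → lookup w k ≡ v
surjective {w = w} inj v = position w (∈-resp-↭ (↭-sym (injective⇒↭allFin {w = w} inj)) (∈-allFin v))
  where
  position : ∀ {k} (w : Vec A k) {v} → v ∈ᴸ toList w → ∃ λ k → lookup w k ≡ v
  position (x ∷ w) (here refl) = zero , refl
  position (x ∷ w) (there v∈) with k , eq ← position w v∈ = suc k , eq

-- Only the tail is sorted. All indices are then successors, so the vertex in front stays and
-- `transition` covers every step.
adjacent-decomposition : ∀ {m} {σ : Vec (Fin (suc m)) (suc m)} → Injective σ → lookup σ zero ≡ zero →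
  ∃ λ l → length l ≤ m * m × (∀ (w : Vec (Fin (suc m)) (suc m)) → act (List.map suc l) w ≡ w ∘ᵛ lookup σ)
adjacent-decomposition {m} {zero ∷ σ} inj refl
  with bubble-sort (tabulate suc) σ (drop-∷ (↭-trans (injective⇒↭allFin {w = tabulate id} id-injective)
         (↭-sym (injective⇒↭allFin {w = zero ∷ σ} inj))))
  where
  id-injective : Injective (tabulate {n = suc m} id)
  id-injective {i} {j} eq = trans (sym (lookup∘tabulate id i)) (trans eq (lookup∘tabulate id j))
... | l , len , eq = l , len , λ w → begin
  act (List.map suc l) w                                  ≡⟨ cong (act (List.map suc l)) (tabulate-id w) ⟩
  act (List.map suc l) (w ∘ᵛ lookup (tabulate id))         ≡⟨ act-∘ᵛ (List.map suc l) w (tabulate id) ⟩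
  w ∘ᵛ lookup (act (List.map suc l) (zero ∷ tabulate suc)) ≡⟨ cong (λ z → w ∘ᵛ lookup z) (act-suc l zero (tabulate suc)) ⟩
  w ∘ᵛ lookup (zero ∷ act l (tabulate suc))                ≡⟨ cong (λ z → w ∘ᵛ lookup (zero ∷ z)) eq ⟩
  w ∘ᵛ lookup (zero ∷ σ)                                   ∎
  where
  open ≡-Reasoning
  tabulate-id : ∀ w → w ≡ w ∘ᵛ lookup (tabulate id)
  tabulate-id w = lookup-ext λ i → sym (trans (lookup-∘ᵛ w (lookup (tabulate id)) i) (cong (lookup w) (lookup∘tabulate id i)))

-- Double counting of words with a given vertex in front

𝟙-∧ : ∀ a b → 𝟙 (a ∧ b) ≡ 𝟙 a * 𝟙 b
𝟙-∧ true  b = sym (*-identityˡ (𝟙 b))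
𝟙-∧ false b = refl

𝟙-mono : ∀ {a b} → (a ≡ true → b ≡ true) → 𝟙 a ≤ 𝟙 b
𝟙-mono {false} _ = z≤n
𝟙-mono {true}  f rewrite f refl = ≤-refl

𝟙*-mono : ∀ {A : Set} (a? : Dec A) {x y} → (A → x ≤ y) → 𝟙 (does a?) * x ≤ 𝟙 (does a?) * y
𝟙*-mono (yes a) f = *-monoʳ-≤ 1 (f a)
𝟙*-mono (no _)  f = z≤n

C-factorial : ∀ {n k} → k ≤ n → (n C k) * (k ! * (n ∸ k) !) ≡ n !
C-factorial {n} {k} k≤n = trans (cong (_* (k ! * (n ∸ k) !)) (nCk≡n!/k![n-k]! k≤n))
  (m/n*n≡m {{k !* (n ∸ k) !≢0}} (k![n∸k]!∣n! k≤n))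

module Stability (m r′ : ℕ) (2r<n : 2 * suc r′ < suc m)
                 (G : RGraph (suc r′) (suc m)) (intersecting : RGraph.Intersecting G) where

  private
    n r : ℕ
    n = suc m
    r = suc r′

  open RGraph G using (edges; size; sizeAvoiding)
  open Circle m r (s≤s z≤n) 2r<n edges intersecting

  r<n : r < n
  r<n = ≤-<-trans (m≤m+n r (1 * r)) 2r<n

  open Counting m r′ r<n hiding (r≤n)

  Word = Vec (Fin n) n

  X : List Word
  X = permutations n

  t = m !

  s : Fin n → Word → ℕ
  s v w = 𝟙 (does (starts-at? v w))

  deg : Fin n → ℕ
  deg v = ∑ edges λ S → 𝟙 (does (v ∈? S))

  deg+avoiding : ∀ v → deg v + sizeAvoiding v ≡ size
  deg+avoiding v = begin
    deg v + sizeAvoiding v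
      ≡⟨ cong (deg v +_) (∑-filter (λ S → ¬? (v ∈? S)) edges) ⟨
    deg v + ∑ edges (λ S → 𝟙 (not (does (v ∈? S))))
      ≡⟨ ∑-+ edges _ _ ⟨
    ∑ edges (λ S → 𝟙 (does (v ∈? S)) + 𝟙 (not (does (v ∈? S))))
      ≡⟨ ∑-cong edges (λ S → 𝟙-not (does (v ∈? S))) ⟩
    ∑ edges (λ _ → 1)
      ≡⟨ trans (∑-const edges 1) (*-identityʳ size) ⟩
    size ∎
    where open ≡-Reasoning

  B₀-expand : ∀ w → 𝟙 (B w 0) ≡ ∑ edges (λ S → 𝟙 (does (image w 0 ≟ˢ S)))
  B₀-expand w with image w 0 ∈ᴸ? edges
  ... | yes I∈ = sym (∑-𝟙≡ (image w 0 ≟ˢ_) edges (RGraph.unique G) I∈ refl sym)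
  ... | no  I∉ = sym (trans (∑-cong-∈ edges λ {S} S∈ → cong 𝟙 (dec-false (image w 0 ≟ˢ S) λ { refl → I∉ S∈ }))
                   (trans (∑-const edges 0) (*-zeroʳ size)))

  ∑B₀ : ∑ X (λ w → 𝟙 (B w 0)) ≡ size * (r * M)
  ∑B₀ = begin
    ∑ X (λ w → 𝟙 (B w 0))
      ≡⟨ ∑-cong X B₀-expand ⟩
    ∑ X (λ w → ∑ edges λ S → 𝟙 (does (image w 0 ≟ˢ S)))
      ≡⟨ ∑-swap X edges _ ⟩
    ∑ edges (λ S → ∑ X λ w → 𝟙 (does (image w 0 ≟ˢ S)))
      ≡⟨ ∑-cong-∈ edges (λ S∈ → count-image (All.lookup (RGraph.uniform G) S∈)) ⟩
    ∑ edges (λ _ → r ! * (n ∸ r) !)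
      ≡⟨ ∑-const edges _ ⟩
    size * (r ! * (n ∸ r) !)
      ≡⟨ cong (size *_) (*-assoc r (r′ !) ((n ∸ r) !)) ⟩
    size * (r * M) ∎
    where open ≡-Reasoning

  ∑sB₀ : ∀ v → ∑ X (λ w → s v w * 𝟙 (B w 0)) ≡ deg v * M
  ∑sB₀ v = begin
    ∑ X (λ w → s v w * 𝟙 (B w 0))
      ≡⟨ ∑-cong X (λ w → trans (cong (s v w *_) (B₀-expand w)) (sym (∑-*ˡ edges (s v w) _))) ⟩
    ∑ X (λ w → ∑ edges λ S → s v w * 𝟙 (does (image w 0 ≟ˢ S)))
      ≡⟨ ∑-swap X edges _ ⟩
    ∑ edges (λ S → ∑ X λ w → s v w * 𝟙 (does (image w 0 ≟ˢ S)))
      ≡⟨ ∑-cong edges (λ S → ∑-cong X λ w → sym (𝟙-∧ (does (starts-at? v w)) _)) ⟩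
    ∑ edges (λ S → ∑ X λ w → 𝟙 (does (starts-at? v w ×-dec (image w 0 ≟ˢ S))))
      ≡⟨ ∑-cong-∈ edges (λ {S} S∈ → count S (All.lookup (RGraph.uniform G) S∈)) ⟩
    ∑ edges (λ S → 𝟙 (does (v ∈? S)) * M)
      ≡⟨ ∑-*ʳ edges _ M ⟩
    deg v * M ∎
    where
    open ≡-Reasoning
    count : ∀ S → ∣ S ∣ ≡ r → ∑ X (λ w → 𝟙 (does (starts-at? v w ×-dec (image w 0 ≟ˢ S)))) ≡ 𝟙 (does (v ∈? S)) * M
    count S ∣S∣ with v ∈? S
    ... | yes v∈S = trans (count-starting-image ∣S∣ v∈S) (sym (*-identityˡ M))
    ... | no  v∉S = count-starting-image-∉ v∉S

  ∑-rotate : (φ : Word → ℕ) → ∑ X (λ w → φ (w ∘ᵛ ρ)) ≡ ∑ X φ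
  ∑-rotate = ∑-∘ᵛʳ ρ ρ⁻¹ ρ∘ρ⁻¹ ρ⁻¹∘ρ

  ρ^ : ℕ → Fin n → Fin n
  ρ^ zero    k = k
  ρ^ (suc i) k = ρ^ i (ρ k)

  toℕ-ρ^ : ∀ i k → toℕ (ρ^ i k) ≡ (toℕ k + i) % n
  toℕ-ρ^ zero    k = sym (trans (cong (_% n) (+-identityʳ (toℕ k))) (m<n⇒m%n≡m (toℕ<n k)))
  toℕ-ρ^ (suc i) k = trans (toℕ-ρ^ i (ρ k)) (trans (cong (λ z → (z + i) % n) (toℕ-ρ k))
    (trans (%-absorbˡ (suc (toℕ k)) i) (cong (_% n) (sym (+-suc (toℕ k) i)))))

  at : Fin n → Fin n → Word → ℕ
  at v k w = 𝟙 (does (lookup w k ≟ᶠ v))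

  -- Each reindexing by `ρ` lowers the arc by one and advances the position by one. In this way all
  -- arcs of the words with v in front become arcs 0 of words with v anywhere.
  ∑-at-rotate : ∀ v i k → ∑ X (λ w → at v k w * 𝟙 (B w i)) ≡ ∑ X (λ w → at v (ρ^ i k) w * 𝟙 (B w 0))
  ∑-at-rotate v zero    k = refl
  ∑-at-rotate v (suc i) k = begin
    ∑ X (λ w → at v k w * 𝟙 (B w (suc i)))
      ≡⟨ ∑-rotate (λ w → at v k w * 𝟙 (B w (suc i))) ⟨
    ∑ X (λ w → at v k (w ∘ᵛ ρ) * 𝟙 (B (w ∘ᵛ ρ) (suc i)))
      ≡⟨ ∑-cong X (λ w → cong₂ (λ x y → 𝟙 (does (x ≟ᶠ v)) * 𝟙 y) (lookup-∘ᵛ w ρ k) (B-rotate w i)) ⟩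
    ∑ X (λ w → at v (ρ k) w * 𝟙 (B w i))
      ≡⟨ ∑-at-rotate v i (ρ k) ⟩
    ∑ X (λ w → at v (ρ^ i (ρ k)) w * 𝟙 (B w 0)) ∎
    where open ≡-Reasoning

  1≤∑at : ∀ v {w} → w ∈ᴸ X → 1 ≤ ∑< n (λ i → at v (ρ^ i zero) w)
  1≤∑at v {w} w∈ with k , eq ← surjective {w = w} (∈-permutations⁻ w∈) v =
    ≤-trans (≤-reflexive (sym (cong 𝟙 (dec-true (lookup w (ρ^ (toℕ k) zero) ≟ᶠ v) (trans (cong (lookup w) k≡) eq)))))
      (∑<-member n (λ i → at v (ρ^ i zero) w) (toℕ<n k))
    where
    k≡ : ρ^ (toℕ k) zero ≡ k
    k≡ = toℕ-injective (trans (toℕ-ρ^ (toℕ k) zero) (m<n⇒m%n≡m (toℕ<n k)))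

  β : Fin n → ℕ
  β v = ∑ X λ w → s v w * bad w

  -- Each vertex is in front in exactly one rotation of a word: fixing v in front saves a factor n.
  β-bound : ∀ v → β v + size * (r * M) ≤ r * t
  β-bound v = begin
    β v + size * (r * M)
      ≡⟨ cong (β v +_) ∑B₀ ⟨
    β v + ∑ X (λ w → 𝟙 (B w 0))
      ≤⟨ +-monoʳ-≤ (β v) (∑-mono-∈ X λ {w} w∈ → ≤-trans (≤-reflexive (sym (*-identityˡ _))) (*-monoˡ-≤ (𝟙 (B w 0)) (1≤∑at v w∈))) ⟩
    β v + ∑ X (λ w → ∑< n (λ i → at v (ρ^ i zero) w) * 𝟙 (B w 0))
      ≡⟨ cong (β v +_) (∑-cong X λ w → ∑<-*ʳ n (λ i → at v (ρ^ i zero) w) (𝟙 (B w 0))) ⟩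
    β v + ∑ X (λ w → ∑< n (λ i → at v (ρ^ i zero) w * 𝟙 (B w 0)))
      ≡⟨ cong (β v +_) (∑<-swap X n λ w i → at v (ρ^ i zero) w * 𝟙 (B w 0)) ⟩
    β v + ∑< n (λ i → ∑ X λ w → at v (ρ^ i zero) w * 𝟙 (B w 0))
      ≡⟨ cong (β v +_) (∑<-cong n λ {i} _ → ∑-at-rotate v i zero) ⟨
    β v + ∑< n (λ i → ∑ X λ w → s v w * 𝟙 (B w i))
      ≡⟨ cong (β v +_) (∑<-swap X n λ w i → s v w * 𝟙 (B w i)) ⟨
    β v + ∑ X (λ w → ∑< n (λ i → s v w * 𝟙 (B w i)))
      ≡⟨ cong (β v +_) (∑-cong X λ w → ∑<-*ˡ n (s v w) (𝟙 ∘ B w)) ⟨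
    β v + ∑ X (λ w → s v w * ∑< n (𝟙 ∘ B w))
      ≡⟨ ∑-+ X _ _ ⟨
    ∑ X (λ w → s v w * bad w + s v w * ∑< n (𝟙 ∘ B w))
      ≡⟨ ∑-cong X (λ w → *-distribˡ-+ (s v w) (bad w) _) ⟨
    ∑ X (λ w → s v w * (bad w + ∑< n (𝟙 ∘ B w)))
      ≤⟨ ∑-mono-∈ X (λ {w} w∈ → *-monoʳ-≤ (s v w) (bad-∑B {w} (∈-permutations⁻ w∈))) ⟩
    ∑ X (λ w → s v w * r)
      ≡⟨ ∑-*ʳ X (s v) r ⟩
    ∑ X (s v) * r
      ≡⟨ trans (cong (_* r) (count-starting m v)) (*-comm t r) ⟩
    r * t ∎
    where
    open ≤-Reasoning
    ∑<-*ˡ : ∀ n c f → c * ∑< n f ≡ ∑< n (λ i → c * f i)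
    ∑<-*ˡ zero    c f = *-zeroʳ c
    ∑<-*ˡ (suc n) c f = trans (*-distribˡ-+ c (f 0) _) (cong (c * f 0 +_) (∑<-*ˡ n c (f ∘ suc)))
    ∑<-*ʳ : ∀ n f c → ∑< n f * c ≡ ∑< n (λ i → f i * c)
    ∑<-*ʳ zero    f c = refl
    ∑<-*ʳ (suc n) f c = trans (*-distribʳ-+ c (f 0) _) (cong (f 0 * c +_) (∑<-*ʳ n (f ∘ suc) c))

  H : Word → Bool
  H = h 0

  q q̄ : Fin n → ℕ
  q v = ∑ X λ w → s v w * 𝟙 (H w)
  q̄ v = ∑ X λ w → s v w * 𝟙 (not (H w))

  q+q̄ : ∀ v → q v + q̄ v ≡ t
  q+q̄ v = trans (sym (∑-+ X _ _)) (trans (∑-cong X λ w → trans (sym (*-distribˡ-+ (s v w) (𝟙 (H w)) _))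
    (trans (cong (s v w *_) (𝟙-not (H w))) (*-identityʳ (s v w)))) (count-starting m v))

  q≤deg : ∀ v → q v ≤ deg v * M
  q≤deg v = ≤-trans (∑-mono-∈ X λ {w} _ → *-monoʳ-≤ (s v w) (𝟙-mono {H w} λ e → all<-elim r {B w} e 0 (s≤s z≤n)))
    (≤-reflexive (∑sB₀ v))

  ∑s : ∀ w → ∑ (allFin n) (λ v → s v w) ≡ 1
  ∑s w = ∑-𝟙≡ (λ v → starts-at? v w) (allFin n) (Unique-allFin n) (∈-allFin (lookup w zero)) refl sym

  ∑∑s : (φ : Word → ℕ) → ∑ (allFin n) (λ v → ∑ X λ w → s v w * φ w) ≡ ∑ X φ
  ∑∑s φ = trans (∑-swap (allFin n) X _) (∑-cong X λ w → trans (∑-*ʳ (allFin n) (λ v → s v w) (φ w))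
    (trans (cong (_* φ w) (∑s w)) (*-identityˡ (φ w))))

  ∑allFin-const : ∀ c → ∑ (allFin n) (λ _ → c) ≡ n * c
  ∑allFin-const c = trans (∑-const (allFin n) c) (cong (_* c) (length-tabulate {n = n} id))

  ∑h : ∀ p → ∑ X (λ w → 𝟙 (h p w)) ≡ ∑ X (λ w → 𝟙 (H w))
  ∑h zero    = refl
  ∑h (suc p) = trans (sym (∑-rotate (λ w → 𝟙 (h (suc p) w))))
    (trans (∑-cong X λ w → cong 𝟙 (h-rotate w p)) (∑h p))

  -- Each of the n! words is exceptional or has a window at some p, and by rotation windows at p are
  -- as frequent as windows at 0. Both totals are then split by the vertex in front.
  n*t≤ : n * t ≤ ∑ (allFin n) β + n * ∑ (allFin n) q
  n*t≤ = begin
    n * t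
      ≡⟨ ∑allFin-const t ⟨
    ∑ (allFin n) (λ _ → t)
      ≡⟨ ∑-cong (allFin n) (λ v → trans (∑-cong X λ w → *-identityʳ (s v w)) (count-starting m v)) ⟨
    ∑ (allFin n) (λ v → ∑ X λ w → s v w * 1)
      ≡⟨ ∑∑s (λ _ → 1) ⟩
    ∑ X (λ _ → 1)
      ≤⟨ ∑-mono-∈ X (λ {w} _ → bad-∑h w) ⟩
    ∑ X (λ w → bad w + ∑< n (λ p → 𝟙 (h p w)))
      ≡⟨ ∑-+ X _ _ ⟩
    ∑ X bad + ∑ X (λ w → ∑< n (λ p → 𝟙 (h p w)))
      ≡⟨ cong (∑ X bad +_) (trans (∑<-swap X n λ w p → 𝟙 (h p w)) (trans (∑<-cong n λ {p} _ → ∑h p) (∑<-const n (∑ X (λ w → 𝟙 (H w)))))) ⟩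
    ∑ X bad + n * ∑ X (λ w → 𝟙 (H w))
      ≡⟨ cong₂ (λ x y → x + n * y) (∑∑s bad) (∑∑s (λ w → 𝟙 (H w))) ⟨
    ∑ (allFin n) β + n * ∑ (allFin n) q ∎
    where open ≤-Reasoning

  ∑-τ : ∀ j (φ : Word → ℕ) → ∑ X (λ w → φ (w ∘ᵛ τ j)) ≡ ∑ X φ
  ∑-τ j = ∑-∘ᵛʳ (τ j) (τ j) (τ-involutive j) (τ-involutive j)

  -- A word that has `H` at the start and not at the end loses it at some step, and that step lands
  -- in an exceptional word. Transpositions permute the words with v in front, so each step accounts
  -- for at most `β v` of them.
  path : ∀ v l → ∑ X (λ w → s v w * (𝟙 (H w) * 𝟙 (not (H (act (List.map suc l) w))))) ≤ length l * β v
  path v List.[] = ≤-reflexive (trans (∑-cong X λ w → trans (cong (s v w *_) (no-change (H w))) (*-zeroʳ (s v w)))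
    (trans (∑-const X 0) (*-zeroʳ (length X))))
    where
    no-change : ∀ b → 𝟙 b * 𝟙 (not b) ≡ 0
    no-change true  = refl
    no-change false = refl
  path v (j List.∷ l) = begin
    ∑ X (λ w → s v w * (𝟙 (H w) * 𝟙 (not (H (act l⁺ (w ∘ᵛ τ (suc j)))))))
      ≤⟨ ∑-mono-∈ X (λ {w} w∈ → ≤-trans (*-monoʳ-≤ (s v w) (≤-trans
           (triangle (H w) (H (w ∘ᵛ τ (suc j))) _)
           (+-monoˡ-≤ _ (transition {w} (∈-permutations⁻ w∈) j))))
           (≤-reflexive (*-distribˡ-+ (s v w) (bad (w ∘ᵛ τ (suc j))) _))) ⟩
    -- Since `τ (suc j)` fixes `zero` by computation, `s v w` is also `s v` of the new word, and the
    -- whole summand becomes a function of that word.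
    ∑ X (λ w → f (w ∘ᵛ τ (suc j)) + g (w ∘ᵛ τ (suc j)))
      ≡⟨ ∑-τ (suc j) (λ w → f w + g w) ⟩
    ∑ X (λ w → f w + g w)
      ≡⟨ ∑-+ X f g ⟩
    β v + ∑ X g
      ≤⟨ +-monoʳ-≤ (β v) (path v l) ⟩
    β v + length l * β v ∎
    where
    open ≤-Reasoning
    l⁺ = List.map suc l
    f g : Word → ℕ
    f w = s v w * bad w
    g w = s v w * (𝟙 (H w) * 𝟙 (not (H (act l⁺ w))))
    triangle : ∀ a b c → 𝟙 a * 𝟙 (not c) ≤ 𝟙 a * 𝟙 (not b) + 𝟙 b * 𝟙 (not c)
    triangle false _     _     = z≤n
    triangle true  _     true  = z≤n
    triangle true  true  false = ≤-refl
    triangle true  false false = ≤-refl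

  front : ∀ v {w} → w ∈ᴸ X → ∀ σ → s v w * s v (w ∘ᵛ lookup σ) ≤ s zero σ * s v w
  front v {w} w∈ σ = ≤-trans (𝟙*-mono (starts-at? v w) {y = s zero σ} λ w₀ → 𝟙-mono λ e →
      dec-true (starts-at? zero σ) (∈-permutations⁻ w∈ (trans
        (trans (sym (lookup-∘ᵛ w (lookup σ) zero)) (does-true (starts-at? v (w ∘ᵛ lookup σ)) e)) (sym w₀))))
    (≤-reflexive (*-comm (s v w) (s zero σ)))

  -- Write the second word of a pair as w followed by σ. With v in front of both, σ fixes position
  -- 0, which leaves t choices, and by `path` each choice accounts for at most m² β pairs.
  q*q̄≤ : ∀ v → q v * q̄ v ≤ t * (m * m * β v)
  q*q̄≤ v = begin
    q v * q̄ v
      ≡⟨ ∑-*ʳ X _ (q̄ v) ⟨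
    ∑ X (λ w → s v w * 𝟙 (H w) * q̄ v)
      ≡⟨ ∑-cong-∈ X (λ {w} w∈ → trans (sym (∑-*ˡ X (s v w * 𝟙 (H w)) _)) (sym (∑-∘ᵛˡ {w = w} (∈-permutations⁻ w∈)
           (λ w′ → s v w * 𝟙 (H w) * (s v w′ * 𝟙 (not (H w′))))))) ⟩
    ∑ X (λ w → ∑ X λ σ → s v w * 𝟙 (H w) * (s v (w ∘ᵛ lookup σ) * 𝟙 (not (H (w ∘ᵛ lookup σ)))))
      ≤⟨ ∑-mono-∈ X (λ {w} w∈ → ∑-mono-∈ X λ {σ} _ → regroup {s v w} {s v (w ∘ᵛ lookup σ)} {s zero σ} {𝟙 (H w)} (front v w∈ σ)) ⟩
    ∑ X (λ w → ∑ X λ σ → s zero σ * (s v w * (𝟙 (H w) * 𝟙 (not (H (w ∘ᵛ lookup σ))))))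
      ≡⟨ trans (∑-swap X X _) (∑-cong X λ σ → ∑-*ˡ X (s zero σ) _) ⟩
    ∑ X (λ σ → s zero σ * ∑ X λ w → s v w * (𝟙 (H w) * 𝟙 (not (H (w ∘ᵛ lookup σ)))))
      ≤⟨ ∑-mono-∈ X (λ {σ} σ∈ → 𝟙*-mono (starts-at? zero σ) (bound σ (∈-permutations⁻ σ∈))) ⟩
    ∑ X (λ σ → s zero σ * (m * m * β v))
      ≡⟨ trans (∑-*ʳ X (s zero) _) (cong (_* (m * m * β v)) (count-starting m zero)) ⟩
    t * (m * m * β v) ∎
    where
    open ≤-Reasoning
    regroup : ∀ {a b c x y} → a * b ≤ c * a → a * x * (b * y) ≤ c * (a * (x * y))
    regroup {a} {b} {c} {x} {y} le = ≤-trans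
      (≤-reflexive (solve 4 (λ a b x y → a :* x :* (b :* y) := a :* b :* (x :* y)) refl a b x y))
      (≤-trans (*-monoˡ-≤ (x * y) le) (≤-reflexive (*-assoc c a (x * y))))
      where open +-*-Solver
    bound : ∀ σ → Injective σ → lookup σ zero ≡ zero →
            ∑ X (λ w → s v w * (𝟙 (H w) * 𝟙 (not (H (w ∘ᵛ lookup σ))))) ≤ m * m * β v
    bound σ inj σ₀ with l , len , eq ← adjacent-decomposition {σ = σ} inj σ₀ = ≤-trans
      (≤-reflexive (∑-cong X λ w → cong (λ z → s v w * (𝟙 (H w) * 𝟙 (not (H z)))) (sym (eq w))))
      (≤-trans (path v l) (*-monoˡ-≤ (β v) len))

  -- From the number of missing edges to a common vertex

  c : ℕ
  c = m C r′

  t≡ : t ≡ c * M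
  t≡ = sym (C-factorial {m} {r′} (<⇒≤ (s≤s⁻¹ r<n)))

  instance
    t≢0 : NonZero t
    t≢0 = m !≢0
    M≢0 : NonZero M
    M≢0 = r′ !* (n ∸ r) !≢0

  -- The Erdős-Ko-Rado bound, obtained from `β-bound` by dropping β. It makes the deficit `c ∸ size`
  -- a true difference.
  size≤c : size ≤ c
  size≤c = *-cancelʳ-≤ size c (r * M) {{m*n≢0 r M}} (begin
    size * (r * M)              ≤⟨ m≤n+m _ (β zero) ⟩
    β zero + size * (r * M)     ≤⟨ β-bound zero ⟩
    r * t                       ≡⟨ cong (r *_) t≡ ⟩
    r * (c * M)                 ≡⟨ solve 3 (λ r c M → r :* (c :* M) := c :* (r :* M)) refl r c M ⟩
    c * (r * M)                 ∎)
    where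
    open ≤-Reasoning
    open +-*-Solver

  module Deficit (d : ℕ) (size+d : size + d ≡ c) where

    ε : ℕ
    ε = r * M * d

    β≤ε : ∀ v → β v ≤ ε
    β≤ε v = +-cancelʳ-≤ (size * (r * M)) (β v) ε (≤-trans (β-bound v) (≤-reflexive (begin
      r * t                       ≡⟨ cong (r *_) (trans t≡ (cong (_* M) (sym size+d))) ⟩
      r * ((size + d) * M)        ≡⟨ solve 4 (λ r z d M → r :* ((z :+ d) :* M) := r :* M :* d :+ z :* (r :* M)) refl r size d M ⟩
      ε + size * (r * M)          ∎)))
      where
      open ≡-Reasoning
      open +-*-Solver

    -- As `q v` and `q̄ v` add up to t, one of them is at least t / 2, which leaves at most 2m²ε for
    -- the other.
    κ : ℕ
    κ = 2 * (m * m * ε)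

    2*q*q̄≤ : ∀ v → q v * (2 * q̄ v) ≤ t * κ
    2*q*q̄≤ v = begin
      q v * (2 * q̄ v)            ≡⟨ solve 2 (λ x y → x :* (con 2 :* y) := con 2 :* (x :* y)) refl (q v) (q̄ v) ⟩
      2 * (q v * q̄ v)            ≤⟨ *-monoʳ-≤ 2 (q*q̄≤ v) ⟩
      2 * (t * (m * m * β v))    ≤⟨ *-monoʳ-≤ 2 (*-monoʳ-≤ t (*-monoʳ-≤ (m * m) (β≤ε v))) ⟩
      2 * (t * (m * m * ε))      ≡⟨ solve 2 (λ x y → con 2 :* (x :* y) := x :* (con 2 :* y)) refl t (m * m * ε) ⟩
      t * κ                      ∎
      where
      open ≤-Reasoning
      open +-*-Solver

    small-q : ∀ v → 2 * q v ≤ t → q v ≤ κ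
    small-q v 2q≤t = *-cancelʳ-≤ (q v) κ t (begin
      q v * t           ≤⟨ *-monoʳ-≤ (q v) t≤2q̄ ⟩
      q v * (2 * q̄ v)   ≤⟨ 2*q*q̄≤ v ⟩
      t * κ             ≡⟨ *-comm t κ ⟩
      κ * t             ∎)
      where
      open ≤-Reasoning
      t≤2q̄ : t ≤ 2 * q̄ v
      t≤2q̄ = +-cancelˡ-≤ t t (2 * q̄ v) (begin
        t + t                 ≡⟨ cong (t +_) (+-identityʳ t) ⟨
        2 * t                 ≡⟨ cong (2 *_) (q+q̄ v) ⟨
        2 * (q v + q̄ v)       ≡⟨ *-distribˡ-+ 2 (q v) (q̄ v) ⟩
        2 * q v + 2 * q̄ v     ≤⟨ +-monoˡ-≤ (2 * q̄ v) 2q≤t ⟩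
        t + 2 * q̄ v           ∎)

    large-q : ∀ v → t < 2 * q v → q̄ v ≤ κ
    large-q v t<2q = *-cancelˡ-≤ (2 * q v) {{>-nonZero (≤-<-trans z≤n t<2q)}} (begin
      2 * q v * q̄ v     ≡⟨ solve 2 (λ x y → con 2 :* x :* y := x :* (con 2 :* y)) refl (q v) (q̄ v) ⟩
      q v * (2 * q̄ v)   ≤⟨ 2*q*q̄≤ v ⟩
      t * κ             ≤⟨ *-monoˡ-≤ κ (<⇒≤ t<2q) ⟩
      2 * q v * κ       ∎)
      where
      open ≤-Reasoning
      open +-*-Solver

    t≤ε+∑q : t ≤ ε + ∑ (allFin n) q
    t≤ε+∑q = *-cancelˡ-≤ n (begin
      n * t                                      ≤⟨ n*t≤ ⟩
      ∑ (allFin n) β + n * ∑ (allFin n) q        ≤⟨ +-monoˡ-≤ _ (∑-mono-∈ (allFin n) λ {v} _ → β≤ε v) ⟩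
      ∑ (allFin n) (λ _ → ε) + n * ∑ (allFin n) q ≡⟨ cong (_+ n * ∑ (allFin n) q) (∑allFin-const ε) ⟩
      n * ε + n * ∑ (allFin n) q                 ≡⟨ *-distribˡ-+ n ε _ ⟨
      n * (ε + ∑ (allFin n) q)                   ∎)
      where open ≤-Reasoning

    2r≤n : 2 * r ≤ n
    2r≤n = <⇒≤ 2r<n

    all-small⇒ : (∀ v → 2 * q v ≤ t) → c ≤ 2 * (n ^ 4 * d)
    all-small⇒ small = *-cancelʳ-≤ c (2 * (n ^ 4 * d)) M (begin
      c * M                              ≡⟨ t≡ ⟨
      t                                  ≤⟨ t≤ε+∑q ⟩
      ε + ∑ (allFin n) q                 ≤⟨ +-monoʳ-≤ ε (∑-mono-∈ (allFin n) λ {v} _ → small-q v (small v)) ⟩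
      ε + ∑ (allFin n) (λ _ → κ)         ≡⟨ cong (ε +_) (∑allFin-const κ) ⟩
      ε + n * κ                          ≡⟨ solve 5 (λ r M d m n → r :* M :* d :+ n :* (con 2 :* (m :* m :* (r :* M :* d)))
                                              := (r :+ con 2 :* r :* (n :* (m :* m))) :* (d :* M)) refl r M d m n ⟩
      -- Each of the two summands is at most n⁴, by 2r ≤ n and m ≤ n.
      (r + 2 * r * (n * (m * m))) * (d * M) ≤⟨ *-monoˡ-≤ (d * M) (+-mono-≤ (≤-trans (m≤m+n r (1 * r)) n≤n⁴)
                                              (*-mono-≤ 2r≤n (*-monoʳ-≤ n (*-mono-≤ (n≤1+n m) (n≤1+n m))))) ⟩
      (n ^ 4 + n * (n * (n * n))) * (d * M) ≡⟨ solve 3 (λ n d M → (n :^ 4 :+ n :* (n :* (n :* n))) :* (d :* M)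
                                              := con 2 :* (n :^ 4 :* d) :* M) refl n d M ⟩
      2 * (n ^ 4 * d) * M                ∎)
      where
      open ≤-Reasoning
      open +-*-Solver
      n≤n⁴ : r + 1 * r ≤ n ^ 4
      n≤n⁴ = ≤-trans 2r≤n (m≤m*n n (n ^ 3) {{m^n≢0 n 3}})

    -- A word pointing out v has an edge through v as arc 0, so `q v` is at most `deg v * M`. With
    -- `q̄ v` small, `deg v` is close to c, which is no less than `size`, and little room is left
    -- for edges that avoid v.
    avoiding≤ : ∀ v → t < 2 * q v → sizeAvoiding v ≤ n ^ 3 * d
    avoiding≤ v t<2q = ≤-trans (+-cancelˡ-≤ (deg v) _ _ (begin
      deg v + sizeAvoiding v             ≡⟨ deg+avoiding v ⟩
      size                               ≤⟨ m≤m+n size d ⟩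
      size + d                           ≡⟨ size+d ⟩
      c                                  ≤⟨ *-cancelʳ-≤ c _ M c*M≤ ⟩
      deg v + 2 * (m * m * (r * d))      ∎))
      (begin
      2 * (m * m * (r * d))   ≡⟨ solve 3 (λ m r d → con 2 :* (m :* m :* (r :* d)) := (con 2 :* r) :* (m :* m) :* d) refl m r d ⟩
      2 * r * (m * m) * d     ≤⟨ *-monoˡ-≤ d (*-mono-≤ 2r≤n (*-mono-≤ (n≤1+n m) (n≤1+n m))) ⟩
      n * (n * n) * d         ≡⟨ solve 2 (λ n d → n :* (n :* n) :* d := n :^ 3 :* d) refl n d ⟩
      n ^ 3 * d               ∎)
      where
      open ≤-Reasoning
      open +-*-Solver
      c*M≤ : c * M ≤ (deg v + 2 * (m * m * (r * d))) * M
      c*M≤ = begin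
        c * M                        ≡⟨ t≡ ⟨
        t                            ≡⟨ q+q̄ v ⟨
        q v + q̄ v                    ≤⟨ +-mono-≤ (q≤deg v) (large-q v t<2q) ⟩
        deg v * M + κ                ≡⟨ solve 5 (λ e M m r d → e :* M :+ con 2 :* (m :* m :* (r :* M :* d))
                                          := (e :+ con 2 :* (m :* m :* (r :* d))) :* M) refl (deg v) M m r d ⟩
        (deg v + 2 * (m * m * (r * d))) * M ∎

    concentrated : 1000 * n ^ 4 * d < c → ∃ λ v → sizeAvoiding v ≤ n ^ 3 * d
    concentrated small-d with any? (λ v → t <? 2 * q v)
    ... | yes (v , t<2q) = v , avoiding≤ v t<2q
    ... | no  none = ⊥-elim (<⇒≱ small-d (begin
      c                   ≤⟨ all-small⇒ (λ v → ≮⇒≥ λ t<2q → none (v , t<2q)) ⟩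
      2 * (n ^ 4 * d)     ≡⟨ *-assoc 2 (n ^ 4) d ⟨
      2 * n ^ 4 * d       ≤⟨ *-monoˡ-≤ d (*-monoˡ-≤ (n ^ 4) {2} {1000} (s≤s (s≤s z≤n))) ⟩
      1000 * n ^ 4 * d    ∎))
      where open ≤-Reasoning

-- Rational estimates and the passage to cuts

toℚᵘ-ℕ→ℚ : ∀ k → ℚ.toℚᵘ (ℕ→ℚ k) ℚᵘ.≃ ℚᵘ.mkℚᵘ (ℤ.+ k) 0
toℚᵘ-ℕ→ℚ k = ℚ.toℚᵘ-fromℚᵘ (ℚᵘ.mkℚᵘ (ℤ.+ k) 0)

-- Normalising `+ k / 1` goes through a gcd that does not compute for variable k; among unnormalised
-- fractions the claim is an identity of integers.
ℕ→ℚ-+ : ∀ j k → ℕ→ℚ (j + k) ≡ ℕ→ℚ j ℚ.+ ℕ→ℚ k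
ℕ→ℚ-+ j k = ℚ.toℚᵘ-injective (begin
  ℚ.toℚᵘ (ℕ→ℚ (j + k))                       ≈⟨ toℚᵘ-ℕ→ℚ (j + k) ⟩
  ℚᵘ.mkℚᵘ (ℤ.+ (j + k)) 0                      ≈⟨ ℚᵘ.*≡* (cong (ℤ._* ℤ.+ 1)
                                                  (cong₂ ℤ._+_ (sym (ℤ.*-identityʳ (ℤ.+ j))) (sym (ℤ.*-identityʳ (ℤ.+ k))))) ⟩
  ℚᵘ.mkℚᵘ (ℤ.+ j) 0 ℚᵘ.+ ℚᵘ.mkℚᵘ (ℤ.+ k) 0       ≈⟨ ℚᵘ.+-cong (toℚᵘ-ℕ→ℚ j) (toℚᵘ-ℕ→ℚ k) ⟨
  ℚ.toℚᵘ (ℕ→ℚ j) ℚᵘ.+ ℚ.toℚᵘ (ℕ→ℚ k)         ≈⟨ ℚ.toℚᵘ-homo-+ (ℕ→ℚ j) (ℕ→ℚ k) ⟨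
  ℚ.toℚᵘ (ℕ→ℚ j ℚ.+ ℕ→ℚ k)                   ∎)
  where open ℚᵘ.≃-Reasoning

ℕ→ℚ-* : ∀ j k → ℕ→ℚ (j * k) ≡ ℕ→ℚ j ℚ.* ℕ→ℚ k
ℕ→ℚ-* j k = ℚ.toℚᵘ-injective (begin
  ℚ.toℚᵘ (ℕ→ℚ (j * k))                       ≈⟨ toℚᵘ-ℕ→ℚ (j * k) ⟩
  ℚᵘ.mkℚᵘ (ℤ.+ (j * k)) 0                      ≈⟨ ℚᵘ.*≡* (cong (ℤ._* ℤ.+ 1) (ℤ.pos-* j k)) ⟩
  ℚᵘ.mkℚᵘ (ℤ.+ j) 0 ℚᵘ.* ℚᵘ.mkℚᵘ (ℤ.+ k) 0       ≈⟨ ℚᵘ.*-cong (toℚᵘ-ℕ→ℚ j) (toℚᵘ-ℕ→ℚ k) ⟨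
  ℚ.toℚᵘ (ℕ→ℚ j) ℚᵘ.* ℚ.toℚᵘ (ℕ→ℚ k)         ≈⟨ ℚ.toℚᵘ-homo-* (ℕ→ℚ j) (ℕ→ℚ k) ⟨
  ℚ.toℚᵘ (ℕ→ℚ j ℚ.* ℕ→ℚ k)                   ∎)
  where open ℚᵘ.≃-Reasoning

ℕ→ℚ-nonNeg : ∀ k → ℚ.NonNegative (ℕ→ℚ k)
ℕ→ℚ-nonNeg k = ℚ.normalize-nonNeg k 1

ℕ→ℚ-mono : ∀ {j k} → j ≤ k → ℕ→ℚ j ℚ.≤ ℕ→ℚ k
ℕ→ℚ-mono {j} {k} j≤k = subst₂ ℚ._≤_ (ℚ.+-identityʳ (ℕ→ℚ j))
  (trans (sym (ℕ→ℚ-+ j (k ∸ j))) (cong ℕ→ℚ (m+[n∸m]≡n j≤k)))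
  (ℚ.+-monoʳ-≤ (ℕ→ℚ j) (ℚ.nonNegative⁻¹ (ℕ→ℚ (k ∸ j)) {{ℕ→ℚ-nonNeg (k ∸ j)}}))

ℕ→ℚ-cancel-< : ∀ {j k} → ℕ→ℚ j ℚ.< ℕ→ℚ k → j < k
ℕ→ℚ-cancel-< {j} {k} lt = ≰⇒> λ k≤j → ℚ.<-irrefl refl (ℚ.<-≤-trans lt (ℕ→ℚ-mono {k} {j} k≤j))

ℕ→ℚ-inverse : ∀ N .{{_ : NonZero N}} → ℕ→ℚ N ℚ.* (ℤ.+ 1 ℚ./ N) ≡ 1ℚ
ℕ→ℚ-inverse (suc N) = ℚ.toℚᵘ-injective (begin
  ℚ.toℚᵘ (ℕ→ℚ (suc N) ℚ.* (ℤ.+ 1 ℚ./ suc N))              ≈⟨ ℚ.toℚᵘ-homo-* (ℕ→ℚ (suc N)) (ℤ.+ 1 ℚ./ suc N) ⟩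
  ℚ.toℚᵘ (ℕ→ℚ (suc N)) ℚᵘ.* ℚ.toℚᵘ (ℤ.+ 1 ℚ./ suc N)      ≈⟨ ℚᵘ.*-cong (toℚᵘ-ℕ→ℚ (suc N)) (ℚ.toℚᵘ-fromℚᵘ (ℚᵘ.mkℚᵘ (ℤ.+ 1) N)) ⟩
  ℚᵘ.mkℚᵘ (ℤ.+ suc N) 0 ℚᵘ.* ℚᵘ.mkℚᵘ (ℤ.+ 1) N              ≈⟨ ℚᵘ.*≡* (cong ℤ.+_ eq) ⟩
  ℚᵘ.1ℚᵘ                                                ∎)
  where
  open ℚᵘ.≃-Reasoning
  open +-*-Solver
  eq : suc N * 1 * 1 ≡ 1 * (1 * suc N)
  eq = solve 1 (λ x → x :* con 1 :* con 1 := con 1 :* (con 1 :* x)) refl (suc N)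

deficit-< : ∀ {g d c} → g + d ≡ c → ∀ {u} → ℕ→ℚ c ℚ.* u ℚ.< ℕ→ℚ g → ℕ→ℚ d ℚ.< ℕ→ℚ c ℚ.* (1ℚ ℚ.- u)
deficit-< {g} {d} {c} refl {u} cu<g = ℚ.≰⇒> λ le → ℚ.<-irrefl refl (begin-strict
  ℕ→ℚ c                                            ≡⟨ split (ℕ→ℚ c) u ⟩
  ℕ→ℚ c ℚ.* u ℚ.+ ℕ→ℚ c ℚ.* (1ℚ ℚ.- u)             <⟨ ℚ.+-mono-<-≤ cu<g le ⟩
  ℕ→ℚ g ℚ.+ ℕ→ℚ d                                  ≡⟨ ℕ→ℚ-+ g d ⟨
  ℕ→ℚ c                                            ∎)
  where
  open ℚ.≤-Reasoning
  split : ∀ x u → x ≡ x ℚ.* u ℚ.+ x ℚ.* (1ℚ ℚ.- u)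
  split = solve 2 (λ x u → x := x :* u :+ x :* (con 1ℚ :- u)) refl
    where open ℚ.+-*-Solver

deficit-small : ∀ {N d c} .{{_ : NonZero N}} {x} → ℕ→ℚ d ℚ.< ℕ→ℚ c ℚ.* x → x ℚ.< ℤ.+ 1 ℚ./ N → N * d < c
deficit-small {N} {d} {c} {x} d<cx x<1/N = ℕ→ℚ-cancel-< {N * d} {c} (begin-strict
  ℕ→ℚ (N * d)                            ≡⟨ ℕ→ℚ-* N d ⟩
  ℕ→ℚ N ℚ.* ℕ→ℚ d                        <⟨ ℚ.*-monoʳ-<-pos (ℕ→ℚ N) {{ℚ.normalize-pos N 1}} d<cx ⟩
  ℕ→ℚ N ℚ.* (ℕ→ℚ c ℚ.* x)                ≤⟨ ℚ.*-monoˡ-≤-nonNeg (ℕ→ℚ N) {{ℕ→ℚ-nonNeg N}}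
                                              (ℚ.*-monoˡ-≤-nonNeg (ℕ→ℚ c) {{ℕ→ℚ-nonNeg c}} (ℚ.<⇒≤ x<1/N)) ⟩
  ℕ→ℚ N ℚ.* (ℕ→ℚ c ℚ.* (ℤ.+ 1 ℚ./ N))      ≡⟨ solve 3 (λ a b e → a :* (b :* e) := b :* (a :* e)) refl (ℕ→ℚ N) (ℕ→ℚ c) (ℤ.+ 1 ℚ./ N) ⟩
  ℕ→ℚ c ℚ.* (ℕ→ℚ N ℚ.* (ℤ.+ 1 ℚ./ N))      ≡⟨ trans (cong (ℕ→ℚ c ℚ.*_) (ℕ→ℚ-inverse N)) (ℚ.*-identityʳ (ℕ→ℚ c)) ⟩
  ℕ→ℚ c                                  ∎)
  where
  open ℚ.≤-Reasoning
  open ℚ.+-*-Solver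

-- Since 1000 n⁴ d < c, a bound linear in d is stronger than one in √(c d).
linear⇒sqrt : ∀ {n c d A p} → 0ℚ ℚ.< p → A ≤ n ^ 3 * d → 1000 * n ^ 4 * d < c → ℕ→ℚ d ℚ.< ℕ→ℚ c ℚ.* (p ℚ.* p) →
              ℕ→ℚ (25 * n * c) ℚ.* p ℚ.< ℕ→ℚ A → ⊥
linear⇒sqrt {n} {c} {d} {A} {p} 0<p A≤ small d<cp² lt = ℚ.<-irrefl refl (begin-strict
  K ℚ.* p ℚ.* (K ℚ.* p)                       ≤⟨ ℚ.*-monoˡ-≤-nonNeg (K ℚ.* p) {{ℚ.nonNegative 0≤Kp}} (ℚ.<⇒≤ lt′) ⟩
  K ℚ.* p ℚ.* ℕ→ℚ (n ^ 3 * d)                 <⟨ ℚ.*-monoˡ-<-pos (ℕ→ℚ (n ^ 3 * d)) {{ℚ.positive (ℚ.≤-<-trans 0≤Kp lt′)}} lt′ ⟩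
  ℕ→ℚ (n ^ 3 * d) ℚ.* ℕ→ℚ (n ^ 3 * d)         ≡⟨ ℕ→ℚ-* (n ^ 3 * d) (n ^ 3 * d) ⟨
  ℕ→ℚ (n ^ 3 * d * (n ^ 3 * d))               ≤⟨ ℕ→ℚ-mono {n ^ 3 * d * (n ^ 3 * d)} {n * n * c * d} square≤ ⟩
  ℕ→ℚ (n * n * c * d)                         ≡⟨ ℕ→ℚ-* (n * n * c) d ⟩
  ℕ→ℚ (n * n * c) ℚ.* ℕ→ℚ d                   ≤⟨ ℚ.*-monoˡ-≤-nonNeg (ℕ→ℚ (n * n * c)) {{ℕ→ℚ-nonNeg (n * n * c)}} (ℚ.<⇒≤ d<cp²) ⟩
  ℕ→ℚ (n * n * c) ℚ.* (ℕ→ℚ c ℚ.* (p ℚ.* p))   ≡⟨ ℚ.*-assoc (ℕ→ℚ (n * n * c)) (ℕ→ℚ c) (p ℚ.* p) ⟨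
  ℕ→ℚ (n * n * c) ℚ.* ℕ→ℚ c ℚ.* (p ℚ.* p)     ≡⟨ cong (ℚ._* (p ℚ.* p)) (ℕ→ℚ-* (n * n * c) c) ⟨
  ℕ→ℚ (n * n * c * c) ℚ.* (p ℚ.* p)           ≤⟨ ℚ.*-monoʳ-≤-nonNeg (p ℚ.* p) {{ℚ.nonNegative 0≤p²}}
                                                   (ℕ→ℚ-mono {n * n * c * c} {25 * n * c * (25 * n * c)} coefficient≤) ⟩
  ℕ→ℚ (25 * n * c * (25 * n * c)) ℚ.* (p ℚ.* p) ≡⟨ cong (ℚ._* (p ℚ.* p)) (ℕ→ℚ-* (25 * n * c) (25 * n * c)) ⟩
  K ℚ.* K ℚ.* (p ℚ.* p)                       ≡⟨ regroup K p ⟩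
  K ℚ.* p ℚ.* (K ℚ.* p)                       ∎)
  where
  open ℚ.≤-Reasoning
  K = ℕ→ℚ (25 * n * c)
  0≤* : ∀ x .{{_ : ℚ.NonNegative x}} → 0ℚ ℚ.≤ x ℚ.* p
  0≤* x = subst (ℚ._≤ x ℚ.* p) (ℚ.*-zeroʳ x) (ℚ.*-monoˡ-≤-nonNeg x (ℚ.<⇒≤ 0<p))
  0≤Kp : 0ℚ ℚ.≤ K ℚ.* p
  0≤Kp = 0≤* K {{ℕ→ℚ-nonNeg (25 * n * c)}}
  0≤p² : 0ℚ ℚ.≤ p ℚ.* p
  0≤p² = 0≤* p {{ℚ.nonNegative (ℚ.<⇒≤ 0<p)}}
  lt′ : K ℚ.* p ℚ.< ℕ→ℚ (n ^ 3 * d)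
  lt′ = ℚ.<-≤-trans lt (ℕ→ℚ-mono {A} {n ^ 3 * d} A≤)
  regroup : ∀ K p → K ℚ.* K ℚ.* (p ℚ.* p) ≡ K ℚ.* p ℚ.* (K ℚ.* p)
  regroup = solve 2 (λ K p → K :* K :* (p :* p) := K :* p :* (K :* p)) refl
    where open ℚ.+-*-Solver
  n⁴d≤c : n ^ 4 * d ≤ c
  n⁴d≤c = ≤-trans (*-monoˡ-≤ d (m≤n*m (n ^ 4) 1000)) (<⇒≤ small)
  -- In the square n⁶d² a factor n⁴d is exchanged for c, which leaves one factor d to be compared
  -- with cp².
  square≤ : n ^ 3 * d * (n ^ 3 * d) ≤ n * n * c * d
  square≤ = ≤-trans (≤-reflexive (solve 2 (λ n d → n :^ 3 :* d :* (n :^ 3 :* d) := n :* n :* (n :^ 4 :* d) :* d) refl n d))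
    (*-monoˡ-≤ d (*-monoʳ-≤ (n * n) n⁴d≤c))
    where open +-*-Solver
  coefficient≤ : n * n * c * c ≤ 25 * n * c * (25 * n * c)
  coefficient≤ = ≤-trans (m≤n*m (n * n * c * c) 625)
    (≤-reflexive (solve 2 (λ n c → con 625 :* (n :* n :* c :* c) := con 25 :* n :* c :* (con 25 :* n :* c)) refl n c))
    where open +-*-Solver

theorem3 : (n r : ℕ) .{{_ : NonZero n}} → 1 ≤ r → 2 * r < n →
    (δ : ℝ) → δ <ℝ fromℚ (10⁻³ n ⁻⁴) →
    (G : RGraph r n) → RGraph.Intersecting G →
    ((n ∸ 1) C (r ∸ 1)) · (1ℚ ⊖ δ) <ℝ fromℕ (RGraph.size G) →
    ∃ λ v → fromℕ (RGraph.sizeAvoiding G v) ≤ℝ (25 * n * ((n ∸ 1) C (r ∸ 1))) · √ δ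
theorem3 n@(suc m) (suc r′) _ 2r<n δ (_ , δ<q , q<1/N) G intersecting (_ , (u , δ>1-u , cu<q) , q<size) =
  let v , A≤ = Deficit.concentrated d size+d small
  -- A failure of the bound unfolds to a positive rational p with p² above δ and 25ncp below the
  -- number of edges avoiding v.
  in v , λ { (_ , (p , (0<p , δ<p²) , kp<q) , q<A) →
       linear⇒sqrt {n} {c} {d} {sizeAvoiding v} 0<p A≤ small
         (ℚ.<-≤-trans d<cx (ℚ.*-monoˡ-≤-nonNeg (ℕ→ℚ c) {{ℕ→ℚ-nonNeg c}} (ℚ.<⇒≤ (ℝ.L<U δ δ>1-u δ<p²))))
         (ℚ.<-trans kp<q q<A) }
  where
  open Stability m r′ 2r<n G intersecting
  open RGraph G using (size; sizeAvoiding)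
  d = c ∸ size
  size+d : size + d ≡ c
  size+d = m+[n∸m]≡n size≤c
  -- `u` lies in the upper cut of 1 - δ, so 1 - u is a rational below δ, and hence below p² and
  -- below the bound on δ.
  d<cx : ℕ→ℚ d ℚ.< ℕ→ℚ c ℚ.* (1ℚ ℚ.- u)
  d<cx = deficit-< {size} {d} {c} size+d (ℚ.<-trans cu<q q<size)
  small : 1000 * n ^ 4 * d < c
  small = deficit-small {1000 * n ^ 4} {d} {c} {{m*n≢0 1000 (n ^ 4) {{_}} {{m^n≢0 n 4}}}} d<cx (ℚ.<-trans (ℝ.L<U δ δ>1-u δ<q) q<1/N)
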